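{- Let $q$ be a power of an odd prime and let $k\geq d\geq 1$ be integers. Then \[ \bigl|\Delta_k\bigl((\mathbb{F}_q^d)^{k+1}\setminus D\bigr)\bigr|\approx q^{d(k+1)-\binom{d+1}{2}}, \] where $\Delta_k(S)$, for a set $S$ of configurations, denotes the set of congruence classes containing at least one element of $S$.
   Context: $\mathbb{F}_q^d$ carries the dot product $x\cdot y=\sum_i x_iy_i$; $O(\mathbb{F}_q^d)$ is the group of linear maps preserving it. Configurations $x,y\in(\mathbb{F}_q^d)^{k+1}$ are congruent if there exist $\theta\in O(\mathbb{F}_q^d)$ and $z\in\mathbb{F}_q^d$ with $y^i=\theta x^i+z$ for all $i$. For $1\leq r<d$, $D_r\subset(\mathbb{F}_q^d)^{k+1}$ is the set of configurations $(x^1,\dots,x^{k+1})$ whose affine span is an $r$-dimensional affine subspace of $\mathbb{F}_q^d$, and $D=\bigcup_{1\leq r<d}D_r$. The notation $X\approx Y$ means $c_1Y\leq X\leq c_2Y$ for positive constants independent of $q$ (allowed to depend on $d$). -}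

module Defs where

open import Algebra.Bundles using (CommutativeRing)
open import Algebra.Module.Bundles.Raw using (RawLeftModule)
open import Algebra.Module.Morphism.Structures using (module LeftModuleMorphisms)
open import Algebra.Structures using (IsCommutativeRing)
open import Data.Fin using (Fin; combine; toℕ)
open import Data.Fin.Properties using (pigeonhole; combine-injective)
open import Data.Integer using (+_)
open import Data.Nat as ℕ using (ℕ; zero; suc; _≤_; _<_)
import Data.Nat.Properties as ℕ
open import Data.Nat.Primality using (Prime)
open import Data.Product using (∃; ∃₂; _×_; _,_; proj₁; proj₂)
open import Data.Rational as ℚ using (ℚ)
open import Data.Vec using (Vec; []; _∷_; foldr′; lookup; map; replicate; zipWith)
import Data.Vec.Properties as Vec
open import Function using (_∘_)
open import Function.Bundles using (Bijection; _↔_; Inverse)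
open import Level using (0ℓ)
open import Relation.Binary using (IsEquivalence; Setoid)
import Relation.Binary.Construct.On as On
open import Relation.Binary.PropositionalEquality
open import Relation.Unary using (Pred; _≐_)

OddPrimePower : ℕ → Set
OddPrimePower q = ∃₂ λ p n → Prime p × p ≢ 2 × 1 ≤ n × q ≡ p ℕ.^ n

-- Fields with exactly q elements.  Such a field is unique up to isomorphism,
-- so quantifying over this record is quantifying over models of 𝔽_q.
record FiniteField (q : ℕ) : Set₁ where
  infixl 6 _+_
  infixl 7 _*_
  infix  8 -_
  field
    Carrier           : Set
    _+_ _*_           : Carrier → Carrier → Carrier
    -_                : Carrier → Carrier
    0# 1#             : Carrier
    isCommutativeRing : IsCommutativeRing _≡_ _+_ _*_ -_ 0# 1#
    0≢1               : 0# ≢ 1#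
    inverse           : ∀ x → x ≢ 0# → ∃ λ y → x * y ≡ 1#
    finite            : Carrier ↔ Fin q

  commutativeRing : CommutativeRing 0ℓ 0ℓ
  commutativeRing = record { isCommutativeRing = isCommutativeRing }

HasCardinality : Setoid 0ℓ 0ℓ → ℕ → Set
HasCardinality S n = Bijection (setoid (Fin n)) S

fromℕ : ℕ → ℚ
fromℕ n = + n ℚ./ 1

module _ {q : ℕ} (F : FiniteField q) where

  private
    module F = FiniteField F
    module R = CommutativeRing F.commutativeRing
  open FiniteField F using (Carrier; _+_; _*_; -_; 0#; 1#)

  Point : ℕ → Set
  Point = Vec Carrier

  infixl 6 _⊕_
  infixr 7 _⊛_

  _⊕_ : ∀ {d} → Point d → Point d → Point d
  _⊕_ = zipWith _+_

  _⊛_ : ∀ {d} → Carrier → Point d → Point d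
  c ⊛ x = map (c *_) x

  ⊝_ : ∀ {d} → Point d → Point d
  ⊝_ = map -_

  0ᵛ : ∀ {d} → Point d
  0ᵛ = replicate _ 0#

  sum : ∀ {m} → Vec Carrier m → Carrier
  sum = foldr′ _+_ 0#

  dot : ∀ {d} → Point d → Point d → Carrier
  dot x y = sum (zipWith _*_ x y)

  pointModule : ℕ → RawLeftModule Carrier 0ℓ 0ℓ
  pointModule d = record
    { Carrierᴹ = Point d
    ; _≈ᴹ_     = _≡_
    ; _+ᴹ_     = _⊕_
    ; _*ₗ_     = _⊛_
    ; 0ᴹ       = 0ᵛ
    ; -ᴹ_      = ⊝_
    }

  IsLinear : ∀ {d} → (Point d → Point d) → Set
  IsLinear {d} = IsLeftModuleHomomorphism
    where open LeftModuleMorphisms (pointModule d) (pointModule d)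

  -- Bijectivity is not required: it follows from preservation of the dot
  -- product (see `invert`).
  record Orthogonal (d : ℕ) : Set where
    field
      ⟦_⟧           : Point d → Point d
      isLinear      : IsLinear ⟦_⟧
      dot-preserved : ∀ x y → dot ⟦ x ⟧ ⟦ y ⟧ ≡ dot x y

  open Orthogonal public using (⟦_⟧)

  Configuration : ℕ → ℕ → Set
  Configuration d k = Vec (Point d) (suc k)

  Congruent : ∀ {d k} → Configuration d k → Configuration d k → Set
  Congruent {d} x y = ∃₂ λ (θ : Orthogonal d) (z : Point d) →
    ∀ i → lookup y i ≡ ⟦ θ ⟧ (lookup x i) ⊕ z

  combination : ∀ {d m} → Vec Carrier m → Vec (Point d) m → Point d
  combination a x = foldr′ _⊕_ 0ᵛ (zipWith _⊛_ a x)

  LinearlyIndependent : ∀ {d m} → Vec (Point d) m → Set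
  LinearlyIndependent {m = m} b =
    ∀ (a : Vec Carrier m) → combination a b ≡ 0ᵛ → a ≡ 0ᵛ

  AffineSpan : ∀ {d m} → Vec (Point d) m → Pred (Point d) 0ℓ
  AffineSpan x v = ∃ λ a → sum a ≡ 1# × v ≡ combination a x

  -- A translate p + W of a linear subspace W with a basis b of r vectors.
  IsAffineSubspace : ∀ {d} → ℕ → Pred (Point d) 0ℓ → Set
  IsAffineSubspace {d} r A = ∃₂ λ (p : Point d) (b : Vec (Point d) r) →
    LinearlyIndependent b × A ≐ (λ v → ∃ λ a → v ≡ p ⊕ combination a b)

  D[_] : ∀ {d k} → ℕ → Pred (Configuration d k) 0ℓ
  D[ r ] x = IsAffineSubspace r (AffineSpan x)

  D : ∀ {d k} → Pred (Configuration d k) 0ℓ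
  D {d} x = ∃ λ r → 1 ≤ r × r < d × D[ r ] x

  dot-zeroʳ : ∀ {d} (x : Point d) → dot x 0ᵛ ≡ 0#
  dot-zeroʳ []       = refl
  dot-zeroʳ (x ∷ xs) =
    trans (cong₂ _+_ (R.zeroʳ x) (dot-zeroʳ xs)) (R.+-identityˡ 0#)

  dot-nondegenerate : ∀ {d} {x y : Point d} → (∀ w → dot x w ≡ dot y w) → x ≡ y
  dot-nondegenerate {x = []}     {[]}     h = refl
  dot-nondegenerate {x = x ∷ xs} {y ∷ ys} h =
    cong₂ _∷_ (trans (sym (head x xs)) (trans (h (1# ∷ 0ᵛ)) (head y ys)))
      (dot-nondegenerate λ w →
        trans (sym (tail x xs w)) (trans (h (0# ∷ w)) (tail y ys w)))
    where
    head : ∀ x {n} (xs : Point n) → dot (x ∷ xs) (1# ∷ 0ᵛ) ≡ x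
    head x xs =
      trans (cong₂ _+_ (R.*-identityʳ x) (dot-zeroʳ xs)) (R.+-identityʳ x)

    tail : ∀ x {n} (xs : Point n) w → dot (x ∷ xs) (0# ∷ w) ≡ dot xs w
    tail x xs w = trans (cong (_+ dot xs w) (R.zeroʳ x)) (R.+-identityˡ _)

  encode : ∀ {d} → Point d → Fin (q ℕ.^ d)
  encode []       = Fin.zero
  encode (x ∷ xs) = combine (Inverse.to F.finite x) (encode xs)

  encode-injective : ∀ {d} {x y : Point d} → encode x ≡ encode y → x ≡ y
  encode-injective {x = []}     {[]}     eq = refl
  encode-injective {x = x ∷ xs} {y ∷ ys} eq
    with eq₁ , eq₂ ← combine-injective _ (encode xs) _ (encode ys) eq =
    cong₂ _∷_
      (trans (sym (Inverse.strictlyInverseʳ F.finite x))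
        (trans (cong (Inverse.from F.finite) eq₁)
          (Inverse.strictlyInverseʳ F.finite y)))
      (encode-injective eq₂)

  iter : ∀ {A : Set} → (A → A) → ℕ → A → A
  iter f zero    x = x
  iter f (suc n) x = f (iter f n x)

  injective⇒surjective : ∀ {d} (f : Point d → Point d) →
    (∀ {x y} → f x ≡ f y → x ≡ y) → ∀ y → ∃ λ x → f x ≡ y
  injective⇒surjective {d} f f-inj y
    with i , j , i<j , eq ← pigeonhole (ℕ.n<1+n (q ℕ.^ d))
                              (λ i → encode (iter f (toℕ i) y))
    = cancel (toℕ i) (toℕ j) i<j (encode-injective eq)
    where
    cancel : ∀ m n → m < n → iter f m y ≡ iter f n y → ∃ λ x → f x ≡ y
    cancel zero    (suc n) _            eq = iter f n y , sym eq
    cancel (suc m) (suc n) (ℕ.s≤s m<n) eq = cancel m n m<n (f-inj eq)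

  ⊕-assoc : ∀ {d} (x y z : Point d) → (x ⊕ y) ⊕ z ≡ x ⊕ (y ⊕ z)
  ⊕-assoc = Vec.zipWith-assoc R.+-assoc

  ⊕-identityʳ : ∀ {d} (x : Point d) → x ⊕ 0ᵛ ≡ x
  ⊕-identityʳ = Vec.zipWith-identityʳ R.+-identityʳ

  ⊕-inverseʳ : ∀ {d} (x : Point d) → x ⊕ ⊝ x ≡ 0ᵛ
  ⊕-inverseʳ = Vec.zipWith-inverseʳ R.-‿inverseʳ

  module LinearMaps {d : ℕ} where
    open LeftModuleMorphisms (pointModule d) (pointModule d) public

  module _ {d : ℕ} where
    open LinearMaps {d} using (module IsLeftModuleHomomorphism)

    linear : {f : Point d → Point d} →
      (∀ x y → f (x ⊕ y) ≡ f x ⊕ f y) → f 0ᵛ ≡ 0ᵛ →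
      (∀ x → f (⊝ x) ≡ ⊝ f x) → (∀ c x → f (c ⊛ x) ≡ c ⊛ f x) → IsLinear f
    linear {f} f-⊕ f-0 f-⊝ f-⊛ = record
      { +ᴹ-isGroupHomomorphism = record
        { isMonoidHomomorphism = record
          { isMagmaHomomorphism = record
            { isRelHomomorphism = record { cong = cong f }
            ; homo = f-⊕
            }
          ; ε-homo = f-0
          }
        ; ⁻¹-homo = f-⊝
        }
      ; *ₗ-homo = f-⊛
      }

    identity : Orthogonal d
    identity = record
      { ⟦_⟧           = λ x → x
      ; isLinear      = linear (λ _ _ → refl) refl (λ _ → refl) (λ _ _ → refl)
      ; dot-preserved = λ _ _ → refl
      }

    compose : Orthogonal d → Orthogonal d → Orthogonal d
    compose φ θ = record
      { ⟦_⟧ = ⟦ φ ⟧ ∘ ⟦ θ ⟧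
      ; isLinear = linear
          (λ x y → trans (cong ⟦ φ ⟧ (Θ.+ᴹ-homo x y)) (Φ.+ᴹ-homo _ _))
          (trans (cong ⟦ φ ⟧ Θ.0ᴹ-homo) Φ.0ᴹ-homo)
          (λ x → trans (cong ⟦ φ ⟧ (Θ.-ᴹ-homo x)) (Φ.-ᴹ-homo _))
          (λ c x → trans (cong ⟦ φ ⟧ (Θ.*ₗ-homo c x)) (Φ.*ₗ-homo c _))
      ; dot-preserved = λ x y →
          trans (Orthogonal.dot-preserved φ _ _) (Orthogonal.dot-preserved θ x y)
      }
      where
      module Θ = IsLeftModuleHomomorphism (Orthogonal.isLinear θ)
      module Φ = IsLeftModuleHomomorphism (Orthogonal.isLinear φ)

    module _ (θ : Orthogonal d) where
      private
        module Θ where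
          open Orthogonal θ public
          open IsLeftModuleHomomorphism isLinear public

      orthogonal-injective : ∀ {x y} → ⟦ θ ⟧ x ≡ ⟦ θ ⟧ y → x ≡ y
      orthogonal-injective {x} {y} eq = dot-nondegenerate λ w →
        trans (sym (Θ.dot-preserved x w))
          (trans (cong (λ v → dot v (⟦ θ ⟧ w)) eq) (Θ.dot-preserved y w))

      preimage : Point d → Point d
      preimage y = proj₁ (injective⇒surjective ⟦ θ ⟧ orthogonal-injective y)

      preimage-inverse : ∀ y → ⟦ θ ⟧ (preimage y) ≡ y
      preimage-inverse y =
        proj₂ (injective⇒surjective ⟦ θ ⟧ orthogonal-injective y)

      preimage-unique : ∀ {x y} → ⟦ θ ⟧ x ≡ y → preimage y ≡ x
      preimage-unique eq =
        orthogonal-injective (trans (preimage-inverse _) (sym eq))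

      invert : Orthogonal d
      invert = record
        { ⟦_⟧ = preimage
        ; isLinear = linear
            (λ x y → preimage-unique (trans (Θ.+ᴹ-homo _ _)
              (cong₂ _⊕_ (preimage-inverse x) (preimage-inverse y))))
            (preimage-unique Θ.0ᴹ-homo)
            (λ x → preimage-unique
              (trans (Θ.-ᴹ-homo _) (cong ⊝_ (preimage-inverse x))))
            (λ c x → preimage-unique
              (trans (Θ.*ₗ-homo c _) (cong (c ⊛_) (preimage-inverse x))))
        ; dot-preserved = λ x y → trans (sym (Θ.dot-preserved _ _))
            (cong₂ dot (preimage-inverse x) (preimage-inverse y))
        }

  congruent-isEquivalence : ∀ {d k} → IsEquivalence (Congruent {d} {k})
  congruent-isEquivalence {d} = record
    { refl  = identity , 0ᵛ , λ i → sym (⊕-identityʳ _)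
    ; sym   = λ { (θ , z , h) → invert θ , ⟦ invert θ ⟧ (⊝ z) , λ i → symEq θ z (h i) }
    ; trans = λ { (θ , z , h) (φ , w , g) →
        compose φ θ , ⟦ φ ⟧ z ⊕ w , λ i → transEq θ z φ w (h i) (g i) }
    }
    where
    open LinearMaps {d} using (module IsLeftModuleHomomorphism)
    homo : ∀ θ x y → ⟦ θ ⟧ (x ⊕ y) ≡ ⟦ θ ⟧ x ⊕ ⟦ θ ⟧ y
    homo θ = IsLeftModuleHomomorphism.+ᴹ-homo (Orthogonal.isLinear θ)

    open ≡-Reasoning

    symEq : ∀ θ z {x y} → y ≡ ⟦ θ ⟧ x ⊕ z → x ≡ ⟦ invert θ ⟧ y ⊕ ⟦ invert θ ⟧ (⊝ z)
    symEq θ z {x} {y} refl = sym (trans (sym (homo (invert θ) y (⊝ z)))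
      (preimage-unique θ (begin
        ⟦ θ ⟧ x                 ≡⟨ ⊕-identityʳ _ ⟨
        ⟦ θ ⟧ x ⊕ 0ᵛ            ≡⟨ cong (⟦ θ ⟧ x ⊕_) (⊕-inverseʳ z) ⟨
        ⟦ θ ⟧ x ⊕ (z ⊕ ⊝ z)     ≡⟨ ⊕-assoc _ _ _ ⟨
        ⟦ θ ⟧ x ⊕ z ⊕ ⊝ z       ∎)))

    transEq : ∀ θ z φ w {x y v} → y ≡ ⟦ θ ⟧ x ⊕ z → v ≡ ⟦ φ ⟧ y ⊕ w →
      v ≡ ⟦ φ ⟧ (⟦ θ ⟧ x) ⊕ (⟦ φ ⟧ z ⊕ w)
    transEq θ z φ w {x} refl refl =
      trans (cong (_⊕ w) (homo φ (⟦ θ ⟧ x) z)) (⊕-assoc _ _ _)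

  congruenceSetoid : ℕ → ℕ → Setoid 0ℓ 0ℓ
  congruenceSetoid d k = record
    { Carrier       = Configuration d k
    ; _≈_           = Congruent
    ; isEquivalence = congruent-isEquivalence
    }

  -- Elements of S up to congruence of the underlying configurations, i.e. the
  -- set of congruence classes that contain at least one element of S.
  Δ : ∀ {d} k → Pred (Configuration d k) 0ℓ → Setoid 0ℓ 0ℓ
  Δ {d} k S = On.setoid {B = ∃ S} (congruenceSetoid d k) proj₁

module Submission where

open import Defs
open import Data.Nat using (ℕ; suc; _≤_; _*_; _∸_; _^_)
open import Data.Nat.Combinatorics using (_C_)
open import Data.Product using (∃; ∃₂; _×_)
open import Data.Rational as ℚ using (ℚ; 0ℚ)
open import Relation.Unary using (∁)

open import Algebra.Bundles using (AbelianGroup; CommutativeRing)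
import Algebra.Properties.AbelianGroup as AbelianGroupProperties
import Algebra.Properties.CommutativeSemigroup as CommutativeSemigroupProperties
import Algebra.Properties.Ring as RingProperties
open import Data.Empty using (⊥; ⊥-elim)
open import Data.Fin as Fin using (Fin; zero; suc; combine; remQuot; punchIn; _↑ˡ_; _↑ʳ_)
import Data.Fin.Properties as Fin
import Data.Integer as ℤ
import Data.Integer.Properties as ℤ
open import Data.List as List using (List; []; _∷_)
open import Data.List.Membership.Propositional using (_∈_; lose)
import Data.List.Membership.Propositional.Properties as ∈
import Data.List.Membership.Setoid.Properties as SetoidMembership
import Data.List.Relation.Unary.All as All
open import Data.List.Relation.Unary.AllPairs using (_∷_)
open import Data.List.Relation.Unary.Any as Any using (Any; here; there)
open import Data.List.Relation.Unary.Any.Properties using (lookup-index)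
open import Data.List.Relation.Unary.Unique.DecSetoid.Properties using (deduplicate-!)
open import Data.List.Relation.Unary.Unique.Setoid using (Unique)
open import Data.Nat as ℕ using (zero; _<_; z≤n; s≤s)
open import Data.Nat.Combinatorics using (nC1≡n; nCk+nC[k+1]≡[n+1]C[k+1])
import Data.Nat.Properties as ℕ
open import Data.Nat.Tactic.RingSolver using (solve-∀)
open import Data.Product using (_,_; proj₁; proj₂)
open import Data.Product.Function.NonDependent.Propositional using (_×-↣_)
open import Data.Rational using (toℚᵘ)
import Data.Rational.Properties as ℚ
open import Data.Rational.Unnormalised as ℚᵘ using (mkℚᵘ)
import Data.Rational.Unnormalised.Properties as ℚᵘ
open import Data.Sum using (_⊎_; inj₁; inj₂)
open import Data.Unit using (⊤; tt)
open import Data.Vec as Vec using (Vec; []; _∷_; lookup; map; zipWith)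
import Data.Vec.Properties as Vec
open import Function using (_∘_)
open import Function.Bundles using (Bijection; Injection; Inverse; _↣_; mk↣)
open import Function.Construct.Composition using (_↣-∘_)
open import Function.Construct.Identity using (↣-id)
open import Function.Properties.Inverse using (↔⇒↣)
open import Level using (0ℓ)
open import Relation.Binary using (Decidable; DecidableEquality; DecSetoid; Setoid)
open import Relation.Binary.PropositionalEquality using
  (_≡_; _≢_; refl; sym; trans; cong; cong₂; subst; isEquivalence; module ≡-Reasoning)
open import Relation.Nullary using (¬_; Dec; yes; no)
open import Relation.Nullary.Decidable using (map′; ¬?; _×-dec_; _→-dec_)
open import Relation.Unary using (Pred)

-- A configuration outside D has differences spanning 0 or all of 𝔽^d.
--
-- Upper bound: read the differences from left to right.  A vector depending on
-- the basis found so far is recorded by its coefficients, any other vector joins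
-- the basis and is recorded by its dot products with the new basis.  This code
-- determines the Gram matrix of the final basis, hence the configuration up to
-- congruence.  Summing over the places where the basis grows costs only a factor
-- 2^d, uniformly in k, because each early dependent vector saves a factor q.
--
-- Lower bound: configurations 0, v₁, …, v_k with vᵢ the rows of a lower
-- triangular matrix with nonzero diagonal span 𝔽^d, and by uniqueness of the
-- Cholesky factorisation at most 2^d of them are congruent to each other.

-- Finite types and decidable quantification over them.

record Finite (A : Set) : Set where
  field
    elements : List A
    complete : ∀ x → x ∈ elements

open Finite

module _ {A : Set} (fin : Finite A) {P : A → Set} (P? : ∀ x → Dec (P x)) where

  exists? : Dec (∃ P)
  exists? = map′ Any.satisfied (λ (x , p) → lose (complete fin x) p)
                 (Any.any? P? (elements fin))

  forall? : Dec (∀ x → P x)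
  forall? = map′ (λ all x → All.lookup all (complete fin x)) (λ p → All.universal p _)
                 (All.all? P? (elements fin))

finite-Vec : ∀ {A} → Finite A → ∀ n → Finite (Vec A n)
finite-Vec fin zero    = record { elements = [] ∷ [] ; complete = λ { [] → here refl } }
finite-Vec fin (suc n) = record
  { elements = List.cartesianProductWith _∷_ (elements fin) (elements (finite-Vec fin n))
  ; complete = λ { (x ∷ xs) →
      ∈.∈-cartesianProductWith⁺ _∷_ (complete fin x) (complete (finite-Vec fin n) xs) }
  }

module _ {A : Set} {P : Pred A 0ℓ} (P? : ∀ x → Dec (P x)) where

  witnesses : List A → List (∃ P)
  witnesses []       = []
  witnesses (x ∷ xs) with P? x
  ... | yes p = (x , p) ∷ witnesses xs
  ... | no _  = witnesses xs

  -- Only first components are compared: the stored proof is the one that `P?` returned, and it may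
  -- differ from the given one.
  ∈-witnesses : ∀ {x xs} → P x → x ∈ xs → Any (λ y → x ≡ proj₁ y) (witnesses xs)
  ∈-witnesses {x} {y ∷ xs} p x∈xs with P? y | x∈xs
  ... | yes _ | here refl  = here refl
  ... | yes _ | there x∈xs′ = there (∈-witnesses p x∈xs′)
  ... | no ¬p | here refl  = ⊥-elim (¬p p)
  ... | no _  | there x∈xs′ = ∈-witnesses p x∈xs′

-- Cardinality of finite setoids.

module _ (S : Setoid 0ℓ 0ℓ) where
  open Setoid S using (_≈_) renaming (Carrier to A; refl to ≈-refl; sym to ≈-sym; trans to ≈-trans)

  lookup-injective : ∀ {xs : List A} → Unique S xs → ∀ {i j} →
    List.lookup xs i ≈ List.lookup xs j → i ≡ j
  lookup-injective (_ ∷ _)   {zero}  {zero}  _  = refl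
  lookup-injective (x≉ ∷ _)  {zero}  {suc j} eq = ⊥-elim (All.lookup x≉ (∈.∈-lookup j) eq)
  lookup-injective (x≉ ∷ _)  {suc i} {zero}  eq = ⊥-elim (All.lookup x≉ (∈.∈-lookup i) (≈-sym eq))
  lookup-injective (_ ∷ xs!) {suc i} {suc j} eq = cong suc (lookup-injective xs! eq)

  -- Deduplicating `xs` up to `_≈_` leaves one representative of each class, and positions in the
  -- resulting list give the bijection.
  finite-cardinality : Decidable _≈_ → ∀ xs → (∀ x → Any (x ≈_) xs) → ∃ (HasCardinality S)
  finite-cardinality _≈?_ xs all = List.length ys , record
    { to        = List.lookup ys
    ; cong      = λ { refl → ≈-refl }
    ; bijective =
        lookup-injective (deduplicate-! classes xs) ,
        λ y → Any.index (y∈ys y) , λ { refl → ≈-sym (lookup-index (y∈ys y)) }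
    }
    where
    classes : DecSetoid 0ℓ 0ℓ
    classes = record
      { isDecEquivalence = record { isEquivalence = Setoid.isEquivalence S ; _≟_ = _≈?_ } }
    ys = List.deduplicate _≈?_ xs
    y∈ys : ∀ y → Any (y ≈_) ys
    y∈ys y = SetoidMembership.∈-deduplicate⁺ S _≈?_ (λ z≈y x≈y → ≈-trans x≈y (≈-sym z≈y)) (all y)

module _ {S : Setoid 0ℓ 0ℓ} {N : ℕ} (card : HasCardinality S N) where
  open Setoid S using (_≈_; Carrier) renaming (sym to ≈-sym; trans to ≈-trans)
  open Bijection card using (to; injective; surjective)

  -- `f` is evaluated only at the representatives chosen by `to`, so a code computed from a
  -- representative can be used directly.
  cardinality-≤ : ∀ {M} (f : Carrier → Fin M) → (∀ {x y} → f x ≡ f y → x ≈ y) → N ≤ M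
  cardinality-≤ f f-inj = Fin.injective⇒≤ {f = f ∘ to} (injective ∘ f-inj)

  class : Carrier → Fin N
  class x = proj₁ (surjective x)

  class-injective : ∀ {x y} → class x ≡ class y → x ≈ y
  class-injective {x} {y} eq =
    ≈-trans (≈-sym (proj₂ (surjective x) refl)) (proj₂ (surjective y) eq)

-- Elementary injections and comparisons on `Fin`.

↑ˡ≢↑ʳ : ∀ {m n} (i : Fin m) (j : Fin n) → i ↑ˡ n ≢ m ↑ʳ j
↑ˡ≢↑ʳ {m} {n} i j eq
  with () ← trans (sym (Fin.splitAt-↑ˡ m i n)) (trans (cong (Fin.splitAt m) eq) (Fin.splitAt-↑ʳ m n j))

-- Stated with `ℕ.pred n` because the field size `q`, a variable, is not syntactically a successor.
avoid : ∀ {n} → Fin n → Fin (ℕ.pred n) → Fin n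
avoid {suc n} = punchIn

avoid-≢ : ∀ {n} (i : Fin n) j → avoid i j ≢ i
avoid-≢ {suc n} = Fin.punchInᵢ≢i

avoid-injective : ∀ {n} (i : Fin n) {j k} → avoid i j ≡ avoid i k → j ≡ k
avoid-injective {suc n} i = Fin.punchIn-injective i _ _

comparison : ∀ {n} → Fin n → Fin n → Fin 2
comparison i j with i Fin.≤? j
... | yes _ = zero
... | no  _ = suc zero

-- For distinct `i` and `j` exactly one of the two inequalities holds, so swapping the arguments
-- flips the bit.
comparison-symmetric : ∀ {n} (i j : Fin n) → comparison i j ≡ comparison j i → i ≡ j
comparison-symmetric i j eq with i Fin.≤? j | j Fin.≤? i
... | yes i≤j | yes j≤i = Fin.≤-antisym i≤j j≤i
... | no  i≰j | no  j≰i = ⊥-elim (j≰i (ℕ.<⇒≤ (ℕ.≰⇒> i≰j)))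
comparison-symmetric i j () | yes _ | no _
comparison-symmetric i j () | no _  | yes _

-- Transfer of inequalities from natural numbers to rationals.

toℚᵘ-fromℕ : ∀ n → toℚᵘ (fromℕ n) ℚᵘ.≃ mkℚᵘ (ℤ.+ n) 0
toℚᵘ-fromℕ n = ℚ.toℚᵘ-fromℚᵘ (mkℚᵘ (ℤ.+ n) 0)

fromℕ-≤ : ∀ {m n} → m ≤ n → fromℕ m ℚ.≤ fromℕ n
fromℕ-≤ {m} {n} m≤n = ℚ.toℚᵘ-cancel-≤ (begin
  toℚᵘ (fromℕ m)  ≃⟨ toℚᵘ-fromℕ m ⟩
  mkℚᵘ (ℤ.+ m) 0    ≤⟨ ℚᵘ.*≤* (ℤ.*-monoʳ-≤-nonNeg (ℤ.+ 1) (ℤ.+≤+ m≤n)) ⟩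
  mkℚᵘ (ℤ.+ n) 0    ≃⟨ toℚᵘ-fromℕ n ⟨
  toℚᵘ (fromℕ n)  ∎)
  where open ℚᵘ.≤-Reasoning

fromℕ-* : ∀ m n → fromℕ (m * n) ≡ fromℕ m ℚ.* fromℕ n
fromℕ-* m n = ℚ.toℚᵘ-injective (begin-equality
  toℚᵘ (fromℕ (m * n))                ≃⟨ toℚᵘ-fromℕ (m * n) ⟩
  mkℚᵘ (ℤ.+ (m * n)) 0                  ≃⟨ ℚᵘ.*≡* (cong (ℤ._* ℤ.+ 1) (ℤ.pos-* m n)) ⟩
  mkℚᵘ (ℤ.+ m) 0 ℚᵘ.* mkℚᵘ (ℤ.+ n) 0      ≃⟨ ℚᵘ.*-cong (toℚᵘ-fromℕ m) (toℚᵘ-fromℕ n) ⟨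
  toℚᵘ (fromℕ m) ℚᵘ.* toℚᵘ (fromℕ n)  ≃⟨ ℚ.toℚᵘ-homo-* (fromℕ m) (fromℕ n) ⟨
  toℚᵘ (fromℕ m ℚ.* fromℕ n)          ∎)
  where open ℚᵘ.≤-Reasoning

fromℕ-positive : ∀ n .{{_ : ℕ.NonZero n}} → ℚ.Positive (fromℕ n)
fromℕ-positive n = ℚ.normalize-pos n 1

fromℕ-≤-* : ∀ {m c n} → m ≤ c * n → fromℕ m ℚ.≤ fromℕ c ℚ.* fromℕ n
fromℕ-≤-* {c = c} {n} m≤cn = ℚ.≤-trans (fromℕ-≤ m≤cn) (ℚ.≤-reflexive (fromℕ-* c n))

reciprocal : (c : ℕ) .{{_ : ℕ.NonZero c}} → ℚ
reciprocal c = (ℚ.1/ fromℕ c) {{ℚ.pos⇒nonZero (fromℕ c) {{fromℕ-positive c}}}}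

reciprocal-positive : ∀ c .{{_ : ℕ.NonZero c}} → ℚ.Positive (reciprocal c)
reciprocal-positive c = ℚ.1/pos⇒pos (fromℕ c) {{fromℕ-positive c}}

reciprocal-≤ : ∀ {m c n} .{{_ : ℕ.NonZero c}} → m ≤ c * n →
  reciprocal c ℚ.* fromℕ m ℚ.≤ fromℕ n
reciprocal-≤ {m} {c} {n} m≤cn = begin
  reciprocal c ℚ.* fromℕ m
    ≤⟨ ℚ.*-monoˡ-≤-nonNeg (reciprocal c) {{ℚ.pos⇒nonNeg (reciprocal c) {{reciprocal-positive c}}}}
         (fromℕ-≤-* {c = c} {n} m≤cn) ⟩
  reciprocal c ℚ.* (fromℕ c ℚ.* fromℕ n)
    ≡⟨ ℚ.*-assoc (reciprocal c) (fromℕ c) (fromℕ n) ⟨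
  reciprocal c ℚ.* fromℕ c ℚ.* fromℕ n
    ≡⟨ cong (ℚ._* fromℕ n)
         (ℚ.*-inverseˡ (fromℕ c) {{ℚ.pos⇒nonZero (fromℕ c) {{fromℕ-positive c}}}}) ⟩
  ℚ.1ℚ ℚ.* fromℕ n
    ≡⟨ ℚ.*-identityˡ (fromℕ n) ⟩
  fromℕ n  ∎
  where open ℚ.≤-Reasoning

-- Counting estimates for codes and triangular matrices.

-- The number of ways to record m vectors, e of which enlarge a basis of j vectors.
codeCount : ℕ → ℕ → ℕ → ℕ → ℕ
codeCount q zero    j zero    = 1
codeCount q (suc e) j zero    = 0
codeCount q zero    j (suc m) = q ^ j * codeCount q zero j m
codeCount q (suc e) j (suc m) =
  q ^ j * codeCount q (suc e) j m ℕ.+ q ^ suc j * codeCount q e (suc j) m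

-- For `d ≤ m` this is the product of `(q - 1) * q ^ (m - 1 - i)` over `i < d`, the number of lower
-- triangular `m × d` matrices with nonzero diagonal.
triangleCount : ℕ → ℕ → ℕ → ℕ
triangleCount q zero    m       = 1
triangleCount q (suc d) zero    = 0
triangleCount q (suc d) (suc m) = (ℕ.pred q * q ^ m) * triangleCount q d m

[1+n]C2≡n+nC2 : ∀ n → suc n C 2 ≡ n ℕ.+ n C 2
[1+n]C2≡n+nC2 n = trans (sym (nCk+nC[k+1]≡[n+1]C[k+1] n 1)) (cong (ℕ._+ n C 2) (nC1≡n n))

module _ {q : ℕ} (1<q : 1 < q) where

  private
    instance
      q≢0 : ℕ.NonZero q
      q≢0 = ℕ.>-nonZero (ℕ.<-trans (s≤s z≤n) 1<q)

  -- The final basis has `e + j` vectors, and each vector read is allowed a factor `q ^ (e + j)`. A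
  -- vector that enlarges the basis costs `q ^ suc j`, and the drop in `e C 2` supplies exactly the
  -- rest of its allowance. A dependent vector costs `q ^ j`, which for positive `e` leaves a spare
  -- factor `q ≥ 2`. Hence each branch takes at most half of the bound.
  codeCount-bound : ∀ e j m → codeCount q e j m * q ^ (e C 2) ≤ 2 ^ e * q ^ ((e ℕ.+ j) * m)
  codeCount-bound zero    j zero    rewrite ℕ.*-zeroʳ j = ℕ.≤-refl
  codeCount-bound (suc e) j zero    = z≤n
  codeCount-bound zero    j (suc m) = begin
    (q ^ j * codeCount q 0 j m) * 1  ≡⟨ ℕ.*-assoc (q ^ j) (codeCount q 0 j m) 1 ⟩
    q ^ j * (codeCount q 0 j m * 1)  ≤⟨ ℕ.*-monoʳ-≤ (q ^ j) (codeCount-bound zero j m) ⟩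
    q ^ j * (1 * q ^ (j * m))        ≡⟨ swap (q ^ j) (q ^ (j * m)) ⟩
    1 * (q ^ j * q ^ (j * m))        ≡⟨ cong (1 *_) (ℕ.^-distribˡ-+-* q j (j * m)) ⟨
    1 * q ^ (j ℕ.+ j * m)            ≡⟨ cong (λ n → 1 * q ^ n) (ℕ.*-suc j m) ⟨
    1 * q ^ (j * suc m)              ∎
    where
    open ℕ.≤-Reasoning
    swap : ∀ x y → x * (1 * y) ≡ 1 * (x * y)
    swap = solve-∀
  codeCount-bound (suc e) j (suc m) = begin
    (q ^ j * X ℕ.+ q ^ suc j * Y) * q ^ (suc e C 2)
      ≡⟨ cong ((q ^ j * X ℕ.+ q ^ suc j * Y) *_) q^C ⟩
    (q ^ j * X ℕ.+ q ^ suc j * Y) * (q ^ e * q ^ (e C 2))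
      ≡⟨ expand (q ^ j) X q Y (q ^ e) (q ^ (e C 2)) ⟩
    q ^ j * (X * (q ^ e * q ^ (e C 2))) ℕ.+ q * (q ^ e * q ^ j) * (Y * q ^ (e C 2))
      ≡⟨ cong (λ c → q ^ j * (X * c) ℕ.+ q * (q ^ e * q ^ j) * (Y * q ^ (e C 2))) q^C ⟨
    q ^ j * (X * q ^ (suc e C 2)) ℕ.+ q * (q ^ e * q ^ j) * (Y * q ^ (e C 2))
      ≤⟨ ℕ.+-mono-≤ (ℕ.*-monoʳ-≤ (q ^ j) (codeCount-bound (suc e) j m))
                    (ℕ.*-monoʳ-≤ (q * (q ^ e * q ^ j)) (codeCount-bound e (suc j) m)) ⟩
    q ^ j * (2 * 2 ^ e * q ^ ((suc e ℕ.+ j) * m))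
      ℕ.+ q * (q ^ e * q ^ j) * (2 ^ e * q ^ ((e ℕ.+ suc j) * m))
      ≡⟨ cong₂ ℕ._+_ (commute (q ^ j) (2 ^ e) Z)
           (cong₂ (λ a n → q * a * (2 ^ e * q ^ (n * m)))
             (sym (ℕ.^-distribˡ-+-* q e j)) (ℕ.+-suc e j)) ⟩
    2 * q ^ j * (2 ^ e * Z) ℕ.+ q ^ r * (2 ^ e * Z)
      -- `2 * q ^ j ≤ q ^ r` lets the factor saved by the dependent vector absorb a 2, so both
      -- branches carry `2 ^ e` instead of `2 ^ suc e`.
      ≤⟨ ℕ.+-monoˡ-≤ (q ^ r * (2 ^ e * Z)) (ℕ.*-monoˡ-≤ (2 ^ e * Z)
           (ℕ.*-mono-≤ 1<q (ℕ.^-monoʳ-≤ q (ℕ.m≤n+m j e)))) ⟩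
    q ^ r * (2 ^ e * Z) ℕ.+ q ^ r * (2 ^ e * Z)
      ≡⟨ double (q ^ r) (2 ^ e) Z ⟩
    2 * 2 ^ e * (q ^ r * Z)
      ≡⟨ cong (2 * 2 ^ e *_) (ℕ.^-distribˡ-+-* q r (r * m)) ⟨
    2 * 2 ^ e * q ^ (r ℕ.+ r * m)
      ≡⟨ cong (λ n → 2 * 2 ^ e * q ^ n) (ℕ.*-suc r m) ⟨
    2 * 2 ^ e * q ^ (r * suc m)  ∎
    where
    open ℕ.≤-Reasoning
    r = suc e ℕ.+ j
    X = codeCount q (suc e) j m
    Y = codeCount q e (suc j) m
    Z = q ^ (r * m)
    q^C : q ^ (suc e C 2) ≡ q ^ e * q ^ (e C 2)
    q^C = trans (cong (q ^_) ([1+n]C2≡n+nC2 e)) (ℕ.^-distribˡ-+-* q e (e C 2))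
    expand : ∀ a x q y b c →
      (a * x ℕ.+ (q * a) * y) * (b * c) ≡ a * (x * (b * c)) ℕ.+ q * (b * a) * (y * c)
    expand = solve-∀
    commute : ∀ a b z → a * (2 * b * z) ≡ 2 * a * (b * z)
    commute = solve-∀
    double : ∀ a b z → a * (b * z) ℕ.+ a * (b * z) ≡ 2 * b * (a * z)
    double = solve-∀

  -- The factor `q ^ (d C 2)` stands for the entries above the diagonal. Each of the `d` diagonal
  -- entries has `q - 1` values, and `q ≤ 2 * (q - 1)` costs one factor 2 apiece.
  triangleCount-bound : ∀ {d m} → d ≤ m →
    q ^ (d * m) ≤ 2 ^ d * triangleCount q d m * q ^ (d C 2)
  triangleCount-bound z≤n = ℕ.≤-refl
  triangleCount-bound {suc d} {suc m} (s≤s d≤m) = begin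
    q ^ (suc d * suc m)
      ≡⟨ cong (q ^_) (exponent d m) ⟩
    q ^ (suc m ℕ.+ (d ℕ.+ d * m))
      ≡⟨ trans (ℕ.^-distribˡ-+-* q (suc m) (d ℕ.+ d * m))
               (cong (q ^ suc m *_) (ℕ.^-distribˡ-+-* q d (d * m))) ⟩
    q * q ^ m * (q ^ d * q ^ (d * m))
      ≤⟨ ℕ.*-mono-≤ (ℕ.*-monoˡ-≤ (q ^ m) (q≤2[q-1] 1<q))
                    (ℕ.*-monoʳ-≤ (q ^ d) (triangleCount-bound d≤m)) ⟩
    2 * ℕ.pred q * q ^ m * (q ^ d * (2 ^ d * T * q ^ (d C 2)))
      ≡⟨ rearrange (ℕ.pred q) (q ^ m) (q ^ d) (2 ^ d) T (q ^ (d C 2)) ⟩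
    2 * 2 ^ d * (ℕ.pred q * q ^ m * T) * (q ^ d * q ^ (d C 2))
      ≡⟨ cong (2 * 2 ^ d * (ℕ.pred q * q ^ m * T) *_)
           (trans (cong (q ^_) ([1+n]C2≡n+nC2 d)) (ℕ.^-distribˡ-+-* q d (d C 2))) ⟨
    2 * 2 ^ d * (ℕ.pred q * q ^ m * T) * q ^ (suc d C 2)  ∎
    where
    open ℕ.≤-Reasoning
    T = triangleCount q d m
    exponent : ∀ d m → suc d * suc m ≡ suc m ℕ.+ (d ℕ.+ d * m)
    exponent = solve-∀
    q≤2[q-1] : ∀ {n} → 1 < n → n ≤ 2 * ℕ.pred n
    q≤2[q-1] {suc n} (s≤s 1≤n) rewrite ℕ.+-identityʳ n = ℕ.+-monoˡ-≤ n 1≤n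
    rearrange : ∀ p a b c t z →
      2 * p * a * (b * (c * t * z)) ≡ 2 * c * (p * a * t) * (b * z)
    rearrange = solve-∀

  dC2≤d*k : ∀ {d k} → d ≤ k → d C 2 ≤ d * k
  dC2≤d*k {zero}  _   = z≤n
  dC2≤d*k {suc d} {k} d<k = begin
    suc d C 2      ≡⟨ [1+n]C2≡n+nC2 d ⟩
    d ℕ.+ d C 2    ≤⟨ ℕ.+-mono-≤ (ℕ.<⇒≤ d<k) (dC2≤d*k (ℕ.<⇒≤ d<k)) ⟩
    k ℕ.+ d * k    ∎
    where open ℕ.≤-Reasoning

  -- Since `suc d C 2` exceeds `d C 2` by `d`, it cancels the coordinates of one point; `dC2≤d*k`
  -- makes the truncated subtraction exact.
  q^-split : ∀ {d k} → d ≤ k →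
    q ^ (d * k) ≡ q ^ (d * suc k ∸ suc d C 2) * q ^ (d C 2)
  q^-split {d} {k} d≤k = begin
    q ^ (d * k)                              ≡⟨ cong (q ^_) (ℕ.m∸n+n≡m (dC2≤d*k d≤k)) ⟨
    q ^ (d * k ∸ d C 2 ℕ.+ d C 2)            ≡⟨ ℕ.^-distribˡ-+-* q (d * k ∸ d C 2) (d C 2) ⟩
    q ^ (d * k ∸ d C 2) * q ^ (d C 2)        ≡⟨ cong (λ n → q ^ n * q ^ (d C 2)) exponent ⟨
    q ^ (d * suc k ∸ suc d C 2) * q ^ (d C 2) ∎
    where
    open ≡-Reasoning
    exponent : d * suc k ∸ suc d C 2 ≡ d * k ∸ d C 2
    exponent = trans (cong₂ _∸_ (ℕ.*-suc d k) ([1+n]C2≡n+nC2 d))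
                     (ℕ.[m+n]∸[m+o]≡n∸o d (d * k) (d C 2))

  -- One factor `2 ^ d` is lost in `triangleCount-bound`, the other is the multiplicity allowed by
  -- the hypothesis on `triangleCount`.
  lower-bound : ∀ {d k N} → d ≤ k → triangleCount q d k ≤ N * 2 ^ d →
    q ^ (d * suc k ∸ suc d C 2) ≤ 2 ^ d * 2 ^ d * N
  lower-bound {d} {k} {N} d≤k T≤N = ℕ.*-cancelʳ-≤ _ _ (q ^ (d C 2)) {{ℕ.m^n≢0 q (d C 2)}} (begin
    q ^ (d * suc k ∸ suc d C 2) * q ^ (d C 2)   ≡⟨ q^-split d≤k ⟨
    q ^ (d * k)                                 ≤⟨ triangleCount-bound d≤k ⟩
    2 ^ d * triangleCount q d k * q ^ (d C 2)
      ≤⟨ ℕ.*-monoˡ-≤ (q ^ (d C 2)) (ℕ.*-monoʳ-≤ (2 ^ d) T≤N) ⟩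
    2 ^ d * (N * 2 ^ d) * q ^ (d C 2)           ≡⟨ cong (_* q ^ (d C 2)) (commute (2 ^ d) N) ⟩
    2 ^ d * 2 ^ d * N * q ^ (d C 2)             ∎)
    where
    open ℕ.≤-Reasoning
    commute : ∀ a n → a * (n * a) ≡ a * a * n
    commute = solve-∀

  upper-bound : ∀ {d k N} → d ≤ k → N ≤ codeCount q 0 0 k ℕ.+ codeCount q d 0 k →
    N ≤ (1 ℕ.+ 2 ^ d) * q ^ (d * suc k ∸ suc d C 2)
  upper-bound {d} {k} {N} d≤k N≤ = begin
    N                                             ≤⟨ N≤ ⟩
    codeCount q 0 0 k ℕ.+ codeCount q d 0 k
      -- The rank 0 summand is at most 1; it is then absorbed into the constant through `1 ≤ q ^ E`.
      ≤⟨ ℕ.+-mono-≤ (ℕ.≤-trans (ℕ.≤-reflexive (sym (ℕ.*-identityʳ (codeCount q 0 0 k)))) (codeCount-bound 0 0 k))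
           (ℕ.*-cancelʳ-≤ (codeCount q d 0 k) (2 ^ d * q ^ E) (q ^ (d C 2))
             {{ℕ.m^n≢0 q (d C 2)}} full-rank) ⟩
    1 ℕ.+ 2 ^ d * q ^ E                           ≤⟨ ℕ.+-monoˡ-≤ _ (ℕ.m^n>0 q E) ⟩
    (1 ℕ.+ 2 ^ d) * q ^ E                         ∎
    where
    open ℕ.≤-Reasoning
    E = d * suc k ∸ suc d C 2
    full-rank : codeCount q d 0 k * q ^ (d C 2) ≤ 2 ^ d * q ^ E * q ^ (d C 2)
    full-rank = begin
      codeCount q d 0 k * q ^ (d C 2)   ≤⟨ codeCount-bound d 0 k ⟩
      2 ^ d * q ^ ((d ℕ.+ 0) * k)       ≡⟨ cong (λ n → 2 ^ d * q ^ (n * k)) (ℕ.+-identityʳ d) ⟩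
      2 ^ d * q ^ (d * k)               ≡⟨ cong (2 ^ d *_) (q^-split d≤k) ⟩
      2 ^ d * (q ^ E * q ^ (d C 2))     ≡⟨ ℕ.*-assoc (2 ^ d) (q ^ E) (q ^ (d C 2)) ⟨
      2 ^ d * q ^ E * q ^ (d C 2)       ∎

-- Coordinate linear algebra over the field.

module _ {q : ℕ} (F : FiniteField q) where

  open FiniteField F using (Carrier; 0#; 1#; _+_; -_; 0≢1; inverse; finite; commutativeRing)
    renaming (_*_ to infixl 7 _·_)

  private
    module R where
      open CommutativeRing commutativeRing public
      open RingProperties ring public
      open CommutativeSemigroupProperties
        (AbelianGroup.commutativeSemigroup +-abelianGroup) public
        using () renaming (interchange to +-interchange)

    infixl 6 _+ᵛ_
    infixr 7 _*ᵛ_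
    infix  8 _∙_

    𝔽^ : ℕ → Set
    𝔽^ = Point F

    _+ᵛ_ : ∀ {d} → 𝔽^ d → 𝔽^ d → 𝔽^ d
    _+ᵛ_ = _⊕_ F

    -ᵛ_ : ∀ {d} → 𝔽^ d → 𝔽^ d
    -ᵛ_ = ⊝_ F

    _*ᵛ_ : ∀ {d} → Carrier → 𝔽^ d → 𝔽^ d
    _*ᵛ_ = _⊛_ F

    𝟎 : ∀ {d} → 𝔽^ d
    𝟎 = 0ᵛ F

    _∙_ : ∀ {d} → 𝔽^ d → 𝔽^ d → Carrier
    _∙_ = dot F

    comb : ∀ {d m} → 𝔽^ m → Vec (𝔽^ d) m → 𝔽^ d
    comb = combination F

  +ᵛ-abelianGroup : ℕ → AbelianGroup 0ℓ 0ℓ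
  +ᵛ-abelianGroup d = record
    { Carrier = 𝔽^ d ; _≈_ = _≡_ ; _∙_ = _+ᵛ_ ; ε = 𝟎 ; _⁻¹ = -ᵛ_
    ; isAbelianGroup = record
      { isGroup = record
        { isMonoid = record
          { isSemigroup = record
            { isMagma = record { isEquivalence = isEquivalence ; ∙-cong = cong₂ _+ᵛ_ }
            ; assoc = Vec.zipWith-assoc R.+-assoc
            }
          ; identity = Vec.zipWith-identityˡ R.+-identityˡ , Vec.zipWith-identityʳ R.+-identityʳ
          }
        ; inverse = Vec.zipWith-inverseˡ R.-‿inverseˡ , Vec.zipWith-inverseʳ R.-‿inverseʳ
        ; ⁻¹-cong = cong -ᵛ_
        }
      ; comm = Vec.zipWith-comm R.+-comm
      }
    }

  private
    module V {d : ℕ} where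
      open AbelianGroup (+ᵛ-abelianGroup d) public
        using (assoc; comm; identityˡ; identityʳ; inverseʳ)
      open AbelianGroupProperties (+ᵛ-abelianGroup d) public
      open CommutativeSemigroupProperties
        (AbelianGroup.commutativeSemigroup (+ᵛ-abelianGroup d)) public
        using (interchange)

  *ᵛ-distribʳ : ∀ {d} c e (v : 𝔽^ d) → (c + e) *ᵛ v ≡ c *ᵛ v +ᵛ e *ᵛ v
  *ᵛ-distribʳ c e []      = refl
  *ᵛ-distribʳ c e (x ∷ v) = cong₂ _∷_ (R.distribʳ x c e) (*ᵛ-distribʳ c e v)

  *ᵛ-distribˡ : ∀ {d} c (u v : 𝔽^ d) → c *ᵛ (u +ᵛ v) ≡ c *ᵛ u +ᵛ c *ᵛ v
  *ᵛ-distribˡ c []      []      = refl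
  *ᵛ-distribˡ c (x ∷ u) (y ∷ v) = cong₂ _∷_ (R.distribˡ c x y) (*ᵛ-distribˡ c u v)

  *ᵛ-assoc : ∀ {d} c e (v : 𝔽^ d) → (c · e) *ᵛ v ≡ c *ᵛ e *ᵛ v
  *ᵛ-assoc c e []      = refl
  *ᵛ-assoc c e (x ∷ v) = cong₂ _∷_ (R.*-assoc c e x) (*ᵛ-assoc c e v)

  *ᵛ-identity : ∀ {d} (v : 𝔽^ d) → 1# *ᵛ v ≡ v
  *ᵛ-identity []      = refl
  *ᵛ-identity (x ∷ v) = cong₂ _∷_ (R.*-identityˡ x) (*ᵛ-identity v)

  *ᵛ-zeroˡ : ∀ {d} (v : 𝔽^ d) → 0# *ᵛ v ≡ 𝟎
  *ᵛ-zeroˡ []      = refl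
  *ᵛ-zeroˡ (x ∷ v) = cong₂ _∷_ (R.zeroˡ x) (*ᵛ-zeroˡ v)

  *ᵛ-zeroʳ : ∀ {d} c → c *ᵛ 𝟎 {d} ≡ 𝟎
  *ᵛ-zeroʳ {zero}  c = refl
  *ᵛ-zeroʳ {suc d} c = cong₂ _∷_ (R.zeroʳ c) (*ᵛ-zeroʳ c)

  -1*ᵛ : ∀ {d} (v : 𝔽^ d) → (- 1#) *ᵛ v ≡ -ᵛ v
  -1*ᵛ []      = refl
  -1*ᵛ (x ∷ v) = cong₂ _∷_ (R.-1*x≈-x x) (-1*ᵛ v)

  comb-+ᵛ : ∀ {d m} (a c : 𝔽^ m) (b : Vec (𝔽^ d) m) →
    comb (a +ᵛ c) b ≡ comb a b +ᵛ comb c b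
  comb-+ᵛ []      []      []      = sym (V.identityˡ 𝟎)
  comb-+ᵛ (x ∷ a) (y ∷ c) (v ∷ b) =
    trans (cong₂ _+ᵛ_ (*ᵛ-distribʳ x y v) (comb-+ᵛ a c b))
          (V.interchange (x *ᵛ v) (y *ᵛ v) (comb a b) (comb c b))

  comb-*ᵛ : ∀ {d m} c (a : 𝔽^ m) (b : Vec (𝔽^ d) m) → comb (c *ᵛ a) b ≡ c *ᵛ comb a b
  comb-*ᵛ c []      []      = sym (*ᵛ-zeroʳ c)
  comb-*ᵛ c (x ∷ a) (v ∷ b) =
    trans (cong₂ _+ᵛ_ (*ᵛ-assoc c x v) (comb-*ᵛ c a b))
          (sym (*ᵛ-distribˡ c (x *ᵛ v) (comb a b)))

  comb-𝟎 : ∀ {d m} (b : Vec (𝔽^ d) m) → comb 𝟎 b ≡ 𝟎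
  comb-𝟎 []      = refl
  comb-𝟎 (v ∷ b) = trans (cong₂ _+ᵛ_ (*ᵛ-zeroˡ v) (comb-𝟎 b)) (V.identityˡ 𝟎)

  comb-0∷ : ∀ {d m} (a : 𝔽^ m) v (b : Vec (𝔽^ d) m) → comb (0# ∷ a) (v ∷ b) ≡ comb a b
  comb-0∷ a v b = trans (cong (_+ᵛ comb a b) (*ᵛ-zeroˡ v)) (V.identityˡ (comb a b))

  comb-1∷𝟎 : ∀ {d m} v (b : Vec (𝔽^ d) m) → comb (1# ∷ 𝟎) (v ∷ b) ≡ v
  comb-1∷𝟎 v b = trans (cong₂ _+ᵛ_ (*ᵛ-identity v) (comb-𝟎 b)) (V.identityʳ v)

  -- With the vectors as matrix rows, `zipWith _∷_ s b` prepends the column `s`. This block form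
  -- drives the inductions on dimension for `standard` and `triangular`.
  comb-zipWith-∷ : ∀ {d m} (a s : 𝔽^ m) (b : Vec (𝔽^ d) m) →
    comb a (zipWith _∷_ s b) ≡ a ∙ s ∷ comb a b
  comb-zipWith-∷ []      []      []      = refl
  comb-zipWith-∷ (x ∷ a) (y ∷ s) (v ∷ b) =
    cong ((x · y ∷ x *ᵛ v) +ᵛ_) (comb-zipWith-∷ a s b)

  comb-translate : ∀ {d m} (a : 𝔽^ m) p (w : Vec (𝔽^ d) m) →
    comb a (map (p +ᵛ_) w) ≡ sum F a *ᵛ p +ᵛ comb a w
  comb-translate []      p []      = sym (trans (V.identityʳ _) (*ᵛ-zeroˡ p))
  comb-translate (x ∷ a) p (v ∷ w) =
    trans (cong₂ _+ᵛ_ (*ᵛ-distribˡ x p v) (comb-translate a p w))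
      (trans (V.interchange (x *ᵛ p) (x *ᵛ v) (sum F a *ᵛ p) (comb a w))
        (cong (_+ᵛ (x *ᵛ v +ᵛ comb a w)) (sym (*ᵛ-distribʳ x (sum F a) p))))

  dot-comm : ∀ {d} (u v : 𝔽^ d) → u ∙ v ≡ v ∙ u
  dot-comm []      []      = refl
  dot-comm (x ∷ u) (y ∷ v) = cong₂ _+_ (R.*-comm x y) (dot-comm u v)

  dot-+ᵛ : ∀ {d} (u v w : 𝔽^ d) → (u +ᵛ v) ∙ w ≡ u ∙ w + v ∙ w
  dot-+ᵛ []      []      []      = sym (R.+-identityˡ 0#)
  dot-+ᵛ (x ∷ u) (y ∷ v) (z ∷ w) =
    trans (cong₂ _+_ (R.distribʳ z x y) (dot-+ᵛ u v w))
          (R.+-interchange (x · z) (y · z) (u ∙ w) (v ∙ w))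

  dot-*ᵛ : ∀ {d} c (u v : 𝔽^ d) → (c *ᵛ u) ∙ v ≡ c · u ∙ v
  dot-*ᵛ c []      []      = sym (R.zeroʳ c)
  dot-*ᵛ c (x ∷ u) (y ∷ v) =
    trans (cong₂ _+_ (R.*-assoc c x y) (dot-*ᵛ c u v)) (sym (R.distribˡ c (x · y) (u ∙ v)))

  dot-zeroˡ : ∀ {d} (v : 𝔽^ d) → 𝟎 ∙ v ≡ 0#
  dot-zeroˡ v = trans (dot-comm 𝟎 v) (dot-zeroʳ F v)

  dot-comb : ∀ {d m} v (a : 𝔽^ m) (b : Vec (𝔽^ d) m) → v ∙ comb a b ≡ a ∙ map (v ∙_) b
  dot-comb v []      []      = dot-zeroʳ F v
  dot-comb v (x ∷ a) (u ∷ b) = begin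
    v ∙ (x *ᵛ u +ᵛ comb a b)       ≡⟨ dot-comm v (x *ᵛ u +ᵛ comb a b) ⟩
    (x *ᵛ u +ᵛ comb a b) ∙ v       ≡⟨ dot-+ᵛ (x *ᵛ u) (comb a b) v ⟩
    (x *ᵛ u) ∙ v + comb a b ∙ v    ≡⟨ cong₂ _+_ (dot-*ᵛ x u v) (dot-comm (comb a b) v) ⟩
    x · u ∙ v + v ∙ comb a b       ≡⟨ cong₂ (λ s t → x · s + t) (dot-comm u v) (dot-comb v a b) ⟩
    x · v ∙ u + a ∙ map (v ∙_) b   ∎
    where open ≡-Reasoning

  -- Respecting zero and negation is homogeneity at the scalars 0 and -1.
  linear-from : ∀ {d} {f : 𝔽^ d → 𝔽^ d} → (∀ u v → f (u +ᵛ v) ≡ f u +ᵛ f v) →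
    (∀ c v → f (c *ᵛ v) ≡ c *ᵛ f v) → IsLinear F f
  linear-from {f = f} additive homogeneous = linear F additive
    (trans (cong f (sym (*ᵛ-zeroˡ 𝟎))) (trans (homogeneous 0# 𝟎) (*ᵛ-zeroˡ (f 𝟎))))
    (λ v → trans (cong f (sym (-1*ᵛ v))) (trans (homogeneous (- 1#) v) (-1*ᵛ (f v))))
    homogeneous

  module _ {d} (θ : Orthogonal F d) where
    open LinearMaps F {d} using (module IsLeftModuleHomomorphism)
    private module Θ = IsLeftModuleHomomorphism (Orthogonal.isLinear θ)

    orthogonal-+ᵛ : ∀ u v → ⟦ θ ⟧ (u +ᵛ v) ≡ ⟦ θ ⟧ u +ᵛ ⟦ θ ⟧ v
    orthogonal-+ᵛ = Θ.+ᴹ-homo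

    orthogonal-𝟎 : ⟦ θ ⟧ 𝟎 ≡ 𝟎
    orthogonal-𝟎 = Θ.0ᴹ-homo

    orthogonal-comb : ∀ {m} (a : 𝔽^ m) b →
      ⟦ θ ⟧ (comb a b) ≡ comb a (map (⟦ θ ⟧) b)
    orthogonal-comb []      []      = Θ.0ᴹ-homo
    orthogonal-comb (x ∷ a) (v ∷ b) =
      trans (Θ.+ᴹ-homo _ _) (cong₂ _+ᵛ_ (Θ.*ₗ-homo x v) (orthogonal-comb a b))

  independent-injective : ∀ {d m} {b : Vec (𝔽^ d) m} → LinearlyIndependent F b →
    ∀ {a c} → comb a b ≡ comb c b → a ≡ c
  independent-injective {b = b} b-ind {a} {c} eq =
    V.x∙y⁻¹≈ε⇒x≈y a c (b-ind _ (begin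
      comb (a +ᵛ -ᵛ c) b         ≡⟨ comb-+ᵛ a (-ᵛ c) b ⟩
      comb a b +ᵛ comb (-ᵛ c) b  ≡⟨ cong (λ e → comb a b +ᵛ comb e b) (-1*ᵛ c) ⟨
      comb a b +ᵛ comb ((- 1#) *ᵛ c) b
        ≡⟨ cong₂ _+ᵛ_ eq (trans (comb-*ᵛ (- 1#) c b) (-1*ᵛ (comb c b))) ⟩
      comb c b +ᵛ -ᵛ comb c b    ≡⟨ V.inverseʳ (comb c b) ⟩
      𝟎                          ∎))
    where open ≡-Reasoning

  -- Enumeration of the field, and decidability of `D` and of congruence.

  private
    toFin : Carrier → Fin q
    toFin = Inverse.to finite

    fromFin : Fin q → Carrier
    fromFin = Inverse.from finite

  toFin-injective : ∀ {x y} → toFin x ≡ toFin y → x ≡ y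
  toFin-injective {x} {y} eq = trans (sym (Inverse.strictlyInverseʳ finite x))
    (trans (cong fromFin eq) (Inverse.strictlyInverseʳ finite y))

  fromFin-injective : ∀ {i j} → fromFin i ≡ fromFin j → i ≡ j
  fromFin-injective {i} {j} eq = trans (sym (Inverse.strictlyInverseˡ finite i))
    (trans (cong toFin eq) (Inverse.strictlyInverseˡ finite j))

  _≟_ : DecidableEquality Carrier
  x ≟ y = map′ toFin-injective (cong toFin) (toFin x Fin.≟ toFin y)

  _≟ᵛ_ : ∀ {d} → DecidableEquality (𝔽^ d)
  _≟ᵛ_ = Vec.≡-dec _≟_

  finite-𝔽 : Finite Carrier
  finite-𝔽 = record
    { elements = List.tabulate fromFin
    ; complete = λ x → subst (_∈ List.tabulate fromFin) (Inverse.strictlyInverseʳ finite x)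
                             (∈.∈-tabulate⁺ (toFin x))
    }

  finite-𝔽^ : ∀ d → Finite (𝔽^ d)
  finite-𝔽^ = finite-Vec finite-𝔽

  1<q : 1 < q
  1<q = go q (toFin 0#) (toFin 1#) (0≢1 ∘ toFin-injective)
    where
    go : ∀ n (i j : Fin n) → i ≢ j → 1 < n
    go (suc zero)    zero zero i≢j = ⊥-elim (i≢j refl)
    go (suc (suc _)) _    _    _   = s≤s (s≤s z≤n)

  decode : ∀ d → Fin (q ^ d) → 𝔽^ d
  decode zero    _ = []
  decode (suc d) i = fromFin (proj₁ (remQuot {q} (q ^ d) i)) ∷ decode d (proj₂ (remQuot {q} (q ^ d) i))

  encode-decode : ∀ d i → encode F (decode d i) ≡ i
  encode-decode zero    zero = refl
  encode-decode (suc d) i    = trans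
    (cong₂ combine (Inverse.strictlyInverseˡ finite _) (encode-decode d _))
    (Fin.combine-remQuot {q} (q ^ d) i)

  decode-injective : ∀ d {i j} → decode d i ≡ decode d j → i ≡ j
  decode-injective d {i} {j} eq =
    trans (sym (encode-decode d i)) (trans (cong (encode F) eq) (encode-decode d j))

  -- An injection forces `q ^ m ≤ q ^ n`, and `1 < q` then compares the exponents: dimensions are
  -- bounded by counting points rather than by basis exchange.
  injective⇒dim≤ : ∀ {m n} (f : 𝔽^ m → 𝔽^ n) → (∀ {u v} → f u ≡ f v → u ≡ v) → m ≤ n
  injective⇒dim≤ {m} {n} f f-inj = ℕ.≮⇒≥ λ n<m →
    ℕ.<⇒≱ (ℕ.^-monoʳ-< q 1<q n<m)
      (Fin.injective⇒≤ {f = encode F ∘ f ∘ decode m}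
        (decode-injective m ∘ f-inj ∘ encode-injective F))

  linearlyIndependent? : ∀ {d m} (b : Vec (𝔽^ d) m) → Dec (LinearlyIndependent F b)
  linearlyIndependent? {d} {m} b =
    forall? (finite-𝔽^ m) λ a → (comb a b ≟ᵛ 𝟎) →-dec (a ≟ᵛ 𝟎)

  affineSpan? : ∀ {d m} (x : Vec (𝔽^ d) m) v → Dec (AffineSpan F x v)
  affineSpan? {d} {m} x v =
    exists? (finite-𝔽^ m) λ a → (sum F a ≟ 1#) ×-dec (v ≟ᵛ comb a x)

  D[_]? : ∀ {d k} r (x : Configuration F d k) → Dec (D[_] F r x)
  D[_]? {d} r x =
    exists? (finite-𝔽^ d) λ p →
    exists? (finite-Vec (finite-𝔽^ d) r) λ b →
    linearlyIndependent? b ×-dec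
    -- The two inclusions of `_≐_` are regrouped into one pointwise statement, which can be tested
    -- vector by vector.
    map′ (λ h → (λ {v} → proj₁ (h v)) , (λ {v} → proj₂ (h v))) (λ (f , g) v → f {v} , g {v})
      (forall? (finite-𝔽^ d) λ v →
        let v∈? = exists? (finite-𝔽^ r) (λ a → v ≟ᵛ (p +ᵛ comb a b))
        in (affineSpan? x v →-dec v∈?) ×-dec (v∈? →-dec affineSpan? x v))

  D? : ∀ {d k} (x : Configuration F d k) → Dec (D F x)
  D? {d} x = map′
    (λ (r , r<d , 1≤r , x∈Dr) → r , 1≤r , r<d , x∈Dr)
    (λ (r , 1≤r , r<d , x∈Dr) → r , r<d , 1≤r , x∈Dr)
    (ℕ.anyUpTo? (λ r → (1 ℕ.≤? r) ×-dec D[ r ]? x) d)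

  standard : ∀ {d} → Vec (𝔽^ d) d
  standard {zero}  = []
  standard {suc d} = (1# ∷ 𝟎) ∷ zipWith _∷_ 𝟎 standard

  comb-standard : ∀ {d} (v : 𝔽^ d) → comb v standard ≡ v
  comb-standard []      = refl
  comb-standard (x ∷ v) = begin
    x *ᵛ (1# ∷ 𝟎) +ᵛ comb v (zipWith _∷_ 𝟎 standard)
      ≡⟨ cong (x *ᵛ (1# ∷ 𝟎) +ᵛ_) (comb-zipWith-∷ v 𝟎 standard) ⟩
    x · 1# + v ∙ 𝟎 ∷ x *ᵛ 𝟎 +ᵛ comb v standard
      ≡⟨ cong₂ _∷_
           (trans (cong₂ _+_ (R.*-identityʳ x) (dot-zeroʳ F v)) (R.+-identityʳ x))
           (trans (cong₂ _+ᵛ_ (*ᵛ-zeroʳ x) (comb-standard v)) (V.identityˡ v)) ⟩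
    x ∷ v  ∎
    where open ≡-Reasoning

  matrixIsometry : ∀ {d} (M : Vec (𝔽^ d) d) →
    (∀ u v → comb u M ∙ comb v M ≡ u ∙ v) → Orthogonal F d
  matrixIsometry M isometric = record
    { ⟦_⟧           = λ v → comb v M
    ; isLinear      = linear-from (λ u v → comb-+ᵛ u v M) (λ c v → comb-*ᵛ c v M)
    ; dot-preserved = isometric
    }

  matrix : ∀ {d} → Orthogonal F d → Vec (𝔽^ d) d
  matrix θ = map ⟦ θ ⟧ standard

  comb-matrix : ∀ {d} (θ : Orthogonal F d) v → comb v (matrix θ) ≡ ⟦ θ ⟧ v
  comb-matrix θ v =
    trans (sym (orthogonal-comb θ v standard)) (cong ⟦ θ ⟧ (comb-standard v))

  -- An orthogonal map is determined by its values on the standard basis, so a search over `d × d`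
  -- matrices replaces a search over functions.
  congruent? : ∀ {d k} (x y : Configuration F d k) → Dec (Congruent F x y)
  congruent? {d} x y = map′
    (λ (M , isometric , z , h) → matrixIsometry M isometric , z , h)
    (λ (θ , z , h) → matrix θ
      , (λ u v → trans (cong₂ _∙_ (comb-matrix θ u) (comb-matrix θ v))
                       (Orthogonal.dot-preserved θ u v))
      , z , λ i → trans (h i) (cong (_+ᵛ z) (sym (comb-matrix θ (lookup x i)))))
    (exists? (finite-Vec (finite-𝔽^ d) d) λ M →
      (forall? (finite-𝔽^ d) λ u → forall? (finite-𝔽^ d) λ v →
        (comb u M ∙ comb v M) ≟ (u ∙ v)) ×-dec
      (exists? (finite-𝔽^ d) λ z → Fin.all? λ i →
        lookup y i ≟ᵛ (comb (lookup x i) M +ᵛ z)))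

  Δ-cardinality : ∀ d k → ∃ (HasCardinality (Δ F {d} k (∁ (D F))))
  Δ-cardinality d k = finite-cardinality (Δ F k (∁ (D F)))
    (λ (x , _) (y , _) → congruent? x y)
    (witnesses (¬? ∘ D?) (elements configurations))
    -- Congruence looks only at the configurations, so a listed element with the same first
    -- component lies in the required class.
    λ (x , x∉D) → Any.map (λ { refl → Setoid.refl (congruenceSetoid F d k) {x} })
      (∈-witnesses (¬? ∘ D?) x∉D (complete configurations x))
    where
    configurations : Finite (Configuration F d k)
    configurations = finite-Vec (finite-𝔽^ d) (suc k)

  -- Greedy bases and affine spans.

  independent-∷ : ∀ {d m} {v} {b : Vec (𝔽^ d) m} → LinearlyIndependent F b →
    ¬ (∃ λ a → v ≡ comb a b) → LinearlyIndependent F (v ∷ b)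
  independent-∷ {v = v} {b} b-ind v∉b (c ∷ a) eq with c ≟ 0#
  ... | yes refl = cong (0# ∷_) (b-ind a (trans (sym (comb-0∷ a v b)) eq))
  -- A relation with nonzero coefficient `c` can be solved for `v`; the coefficients become `a`
  -- scaled by the negative of the inverse of `c`.
  ... | no c≢0 with y , cy≡1 ← inverse c c≢0 = ⊥-elim (v∉b (y *ᵛ (- 1#) *ᵛ a , (begin
    v                          ≡⟨ *ᵛ-identity v ⟨
    1# *ᵛ v                    ≡⟨ cong (_*ᵛ v) (trans (sym cy≡1) (R.*-comm c y)) ⟩
    (y · c) *ᵛ v               ≡⟨ *ᵛ-assoc y c v ⟩
    y *ᵛ c *ᵛ v                ≡⟨ cong (y *ᵛ_) (V.inverseˡ-unique _ _ eq) ⟩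
    y *ᵛ (-ᵛ comb a b)         ≡⟨ cong (y *ᵛ_) (-1*ᵛ (comb a b)) ⟨
    y *ᵛ (- 1#) *ᵛ comb a b    ≡⟨ cong (y *ᵛ_) (comb-*ᵛ (- 1#) a b) ⟨
    y *ᵛ comb ((- 1#) *ᵛ a) b  ≡⟨ comb-*ᵛ y ((- 1#) *ᵛ a) b ⟨
    comb (y *ᵛ (- 1#) *ᵛ a) b  ∎)))
    where open ≡-Reasoning

  -- The greedy extension of b along w to B, which adjoins e vectors of w.
  data Reduced {d} : ∀ {j m r} → ℕ → Vec (𝔽^ d) j → Vec (𝔽^ d) m → Vec (𝔽^ d) r → Set where
    done : ∀ {j} {b : Vec _ j} → Reduced 0 b [] b
    dep  : ∀ {j m r e} {b : Vec _ j} {w : Vec _ m} {B : Vec _ r} a →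
           Reduced e b w B → Reduced e b (comb a b ∷ w) B
    new  : ∀ {j m r e} {b : Vec _ j} {w : Vec _ m} {B : Vec _ r} {v} →
           Reduced e (v ∷ b) w B → Reduced (suc e) b (v ∷ w) B

  -- The constructor `new` does not itself exclude vectors in the span of `b`. They are excluded
  -- here, and the independence of `B` records this.
  reduce : ∀ {d j m} {b : Vec (𝔽^ d) j} → LinearlyIndependent F b → (w : Vec (𝔽^ d) m) →
    ∃₂ λ e r → ∃ λ (B : Vec (𝔽^ d) r) → LinearlyIndependent F B × Reduced e b w B
  reduce b-ind []      = _ , _ , _ , b-ind , done
  reduce {j = j} {b = b} b-ind (v ∷ w) with exists? (finite-𝔽^ j) (λ a → v ≟ᵛ comb a b)
  ... | yes (a , refl) with _ , _ , _ , B-ind , R ← reduce b-ind w =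
    _ , _ , _ , B-ind , dep a R
  ... | no v∉b with _ , _ , _ , B-ind , R ← reduce (independent-∷ b-ind v∉b) w =
    _ , _ , _ , B-ind , new R

  reduced-length : ∀ {d e j m r} {b : Vec (𝔽^ d) j} {w : Vec (𝔽^ d) m} {B : Vec (𝔽^ d) r} →
    Reduced e b w B → e ℕ.+ j ≡ r
  reduced-length done      = refl
  reduced-length (dep a R) = reduced-length R
  reduced-length (new R)   = trans (sym (ℕ.+-suc _ _)) (reduced-length R)

  -- Together with `reduced-span⁻`: `b` and `w` jointly span what `B` spans. The coefficient of a
  -- dependent vector is merged into those of `b`, while that of a new vector moves to the front of
  -- the enlarged basis.
  reduced-span⁺ : ∀ {d e j m r} {b : Vec (𝔽^ d) j} {w : Vec (𝔽^ d) m} {B : Vec (𝔽^ d) r} →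
    Reduced e b w B → ∀ a c → ∃ λ f → comb a b +ᵛ comb c w ≡ comb f B
  reduced-span⁺ done a [] = a , V.identityʳ _
  reduced-span⁺ {b = b} {B = B} (dep {w = w} a₀ R) a (x ∷ c) with reduced-span⁺ R (a +ᵛ x *ᵛ a₀) c
  ... | f , eq = f , (begin
    comb a b +ᵛ (x *ᵛ comb a₀ b +ᵛ comb c w)    ≡⟨ V.assoc _ _ _ ⟨
    comb a b +ᵛ x *ᵛ comb a₀ b +ᵛ comb c w
      ≡⟨ cong (λ u → comb a b +ᵛ u +ᵛ comb c w) (comb-*ᵛ x a₀ b) ⟨
    comb a b +ᵛ comb (x *ᵛ a₀) b +ᵛ comb c w
      ≡⟨ cong (_+ᵛ comb c w) (comb-+ᵛ a (x *ᵛ a₀) b) ⟨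
    comb (a +ᵛ x *ᵛ a₀) b +ᵛ comb c w           ≡⟨ eq ⟩
    comb f B                                    ∎)
    where open ≡-Reasoning
  reduced-span⁺ {b = b} {B = B} (new {w = w} {v = v} R) a (x ∷ c) with reduced-span⁺ R (x ∷ a) c
  ... | f , eq = f , (begin
    comb a b +ᵛ (x *ᵛ v +ᵛ comb c w)  ≡⟨ V.assoc _ _ _ ⟨
    comb a b +ᵛ x *ᵛ v +ᵛ comb c w    ≡⟨ cong (_+ᵛ comb c w) (V.comm _ _) ⟩
    x *ᵛ v +ᵛ comb a b +ᵛ comb c w    ≡⟨ eq ⟩
    comb f B                          ∎)
    where open ≡-Reasoning

  reduced-span⁻ : ∀ {d e j m r} {b : Vec (𝔽^ d) j} {w : Vec (𝔽^ d) m} {B : Vec (𝔽^ d) r} →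
    Reduced e b w B → ∀ f → ∃₂ λ a c → comb f B ≡ comb a b +ᵛ comb c w
  reduced-span⁻ done f = f , [] , sym (V.identityʳ _)
  reduced-span⁻ (dep {b = b} {w = w} a₀ R) f with reduced-span⁻ R f
  ... | a , c , eq =
    a , 0# ∷ c , trans eq (cong (comb a b +ᵛ_) (sym (comb-0∷ c (comb a₀ b) w)))
  reduced-span⁻ (new {b = b} {w = w} {v = v} R) f with reduced-span⁻ R f
  ... | x ∷ a , c , eq =
    a , x ∷ c , trans eq (trans (cong (_+ᵛ comb c w) (V.comm _ _)) (V.assoc _ _ _))

  differences : ∀ {d k} → Configuration F d k → Vec (𝔽^ d) k
  differences (p ∷ x) = map (-ᵛ p +ᵛ_) x

  translate-differences : ∀ {d k} p (x : Vec (𝔽^ d) k) →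
    p ∷ x ≡ p ∷ map (p +ᵛ_) (differences (p ∷ x))
  translate-differences p x = cong (p ∷_) (sym (trans (sym (Vec.map-∘ _ _ x))
    (trans (Vec.map-cong (λ v → V.\\-leftDividesˡ p v) x) (Vec.map-id x))))

  -- Because the coefficients sum to 1, the base point `p` comes out with coefficient 1.
  affineSpan⁺ : ∀ {d k} {p} {w : Vec (𝔽^ d) k} {v} →
    AffineSpan F (p ∷ map (p +ᵛ_) w) v → ∃ λ a → v ≡ p +ᵛ comb a w
  affineSpan⁺ {p = p} {w} (x ∷ a , x+a≡1 , refl) = a , (begin
    x *ᵛ p +ᵛ comb a (map (p +ᵛ_) w)       ≡⟨ cong (x *ᵛ p +ᵛ_) (comb-translate a p w) ⟩
    x *ᵛ p +ᵛ (sum F a *ᵛ p +ᵛ comb a w)   ≡⟨ V.assoc _ _ _ ⟨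
    x *ᵛ p +ᵛ sum F a *ᵛ p +ᵛ comb a w     ≡⟨ cong (_+ᵛ comb a w) (*ᵛ-distribʳ x (sum F a) p) ⟨
    (x + sum F a) *ᵛ p +ᵛ comb a w         ≡⟨ cong (λ s → s *ᵛ p +ᵛ comb a w) x+a≡1 ⟩
    1# *ᵛ p +ᵛ comb a w                    ≡⟨ cong (_+ᵛ comb a w) (*ᵛ-identity p) ⟩
    p +ᵛ comb a w                          ∎)
    where open ≡-Reasoning

  affineSpan⁻ : ∀ {d k} p (w : Vec (𝔽^ d) k) a →
    AffineSpan F (p ∷ map (p +ᵛ_) w) (p +ᵛ comb a w)
  affineSpan⁻ p w a = x ∷ a , x+a≡1 , sym (proj₂ p+aw)
    where
    -- The weight of the base point is chosen to bring the total to 1.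
    x = 1# + - sum F a
    x+a≡1 : x + sum F a ≡ 1#
    x+a≡1 = trans (R.+-assoc _ _ _)
      (trans (cong (1# +_) (R.-‿inverseˡ (sum F a))) (R.+-identityʳ 1#))
    p+aw = affineSpan⁺ {w = w} (x ∷ a , x+a≡1 , refl)

  -- The affine span is the first point plus the span of the differences, and `B` is a basis of that
  -- span.
  affineSpan-reduced : ∀ {d e k r} x {B : Vec (𝔽^ d) r} → LinearlyIndependent F B →
    Reduced e [] (differences {d} {k} x) B → D[_] F r x
  affineSpan-reduced (p ∷ x) {B} B-ind R = p , B , B-ind ,
    subst (λ y → ∀ {v} → AffineSpan F y v → ∃ λ a → v ≡ p +ᵛ comb a B)
      (sym (translate-differences p x))
      (λ v∈ → let a , v≡ = affineSpan⁺ v∈ ; f , eq = reduced-span⁺ R [] a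
              in f , trans v≡ (cong (p +ᵛ_) (trans (sym (V.identityˡ _)) eq))) ,
    subst (λ y → ∀ {v} → (∃ λ a → v ≡ p +ᵛ comb a B) → AffineSpan F y v)
      (sym (translate-differences p x))
      (λ (f , v≡) → let a , c , eq = reduced-span⁻ R f
              in subst (AffineSpan F _) (sym (trans v≡ (cong (p +ᵛ_) (trans eq (no-coefficients a c)))))
                   (affineSpan⁻ p (differences (p ∷ x)) c))
    where
    no-coefficients : ∀ a c → comb a [] +ᵛ comb c (differences (p ∷ x)) ≡ comb c (differences (p ∷ x))
    no-coefficients [] c = V.identityˡ _

  Profile : ∀ {d k} → Configuration F d k → ℕ → Set
  Profile {d} x e = ∃ λ (B : Vec (𝔽^ d) e) →
    LinearlyIndependent F B × Reduced e [] (differences x) B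

  -- The length of `B` is the dimension of the affine span. It is at most `d` by `injective⇒dim≤`,
  -- and a value strictly between 0 and `d` would put `x` in `D`.
  profile : ∀ {d k} (x : Configuration F d k) → ¬ D F x → Profile x 0 ⊎ Profile x d
  profile {d} x x∉D with reduce {b = []} (λ { [] _ → refl }) (differences x)
  ... | e , r , B , B-ind , R with refl ← trans (sym (ℕ.+-identityʳ e)) (reduced-length R) =
    extremal e (ℕ.m≤n⇒m<n∨m≡n (injective⇒dim≤ _ (independent-injective B-ind))) (B , B-ind , R)
    where
    extremal : ∀ e → e < d ⊎ e ≡ d → Profile x e → Profile x 0 ⊎ Profile x d
    extremal zero    _           P               = inj₁ P
    extremal (suc e) (inj₁ e<d)  (_ , B-ind , R) =
      ⊥-elim (x∉D (suc e , s≤s z≤n , e<d , affineSpan-reduced x B-ind R))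
    extremal (suc e) (inj₂ refl) P               = inj₂ P

  -- Gram matrices and codes of configurations.

  -- Equality of Gram matrices, phrased through the bilinear forms they induce on coefficients; this
  -- is the shape in which it proves that a map is an isometry.
  SameGram : ∀ {d j} → Vec (𝔽^ d) j → Vec (𝔽^ d) j → Set
  SameGram b b′ = ∀ a c → comb a b ∙ comb c b ≡ comb a b′ ∙ comb c b′

  -- By bilinearity, `expand` reduces every product to the new Gram row `map (v ∙_) (v ∷ b)` and the
  -- form on `b`.
  sameGram-∷ : ∀ {d j} {v v′} {b b′ : Vec (𝔽^ d) j} →
    map (v ∙_) (v ∷ b) ≡ map (v′ ∙_) (v′ ∷ b′) → SameGram b b′ →
    SameGram (v ∷ b) (v′ ∷ b′)
  sameGram-∷ {v = v} {v′} {b} {b′} eq same (x ∷ a) (y ∷ c) = begin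
    comb (x ∷ a) (v ∷ b) ∙ comb (y ∷ c) (v ∷ b)
      ≡⟨ expand v b ⟩
    x · (y ∷ c) ∙ map (v ∙_) (v ∷ b) + (y · a ∙ map (v ∙_) b + comb c b ∙ comb a b)
      ≡⟨ cong₂ _+_ (cong (λ u → x · (y ∷ c) ∙ u) eq)
           (cong₂ _+_ (cong (λ u → y · a ∙ Vec.tail u) eq) (same c a)) ⟩
    x · (y ∷ c) ∙ map (v′ ∙_) (v′ ∷ b′) + (y · a ∙ map (v′ ∙_) b′ + comb c b′ ∙ comb a b′)
      ≡⟨ expand v′ b′ ⟨
    comb (x ∷ a) (v′ ∷ b′) ∙ comb (y ∷ c) (v′ ∷ b′)  ∎
    where
    open ≡-Reasoning
    expand : ∀ v b → comb (x ∷ a) (v ∷ b) ∙ comb (y ∷ c) (v ∷ b) ≡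
      x · (y ∷ c) ∙ map (v ∙_) (v ∷ b) + (y · a ∙ map (v ∙_) b + comb c b ∙ comb a b)
    expand v b = begin
      (x *ᵛ v +ᵛ comb a b) ∙ u               ≡⟨ dot-+ᵛ (x *ᵛ v) (comb a b) u ⟩
      (x *ᵛ v) ∙ u + comb a b ∙ u            ≡⟨ cong₂ _+_ (dot-*ᵛ x v u) (dot-comm (comb a b) u) ⟩
      x · v ∙ u + u ∙ comb a b
        ≡⟨ cong₂ _+_ (cong (x ·_) (dot-comb v (y ∷ c) (v ∷ b))) (dot-+ᵛ (y *ᵛ v) (comb c b) (comb a b)) ⟩
      x · (y ∷ c) ∙ map (v ∙_) (v ∷ b) + ((y *ᵛ v) ∙ comb a b + comb c b ∙ comb a b)
        ≡⟨ cong (λ s → x · (y ∷ c) ∙ map (v ∙_) (v ∷ b) + (s + comb c b ∙ comb a b))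
             (trans (dot-*ᵛ y v (comb a b)) (cong (y ·_) (dot-comb v a b))) ⟩
      x · (y ∷ c) ∙ map (v ∙_) (v ∷ b) + (y · a ∙ map (v ∙_) b + comb c b ∙ comb a b)  ∎
      where u = comb (y ∷ c) (v ∷ b)

  -- The indices are those of `codeCount`: enlargements to come, current basis size, vectors left to
  -- read. `new` stores `suc j` values because the product of the vector with itself is included.
  data Code : ℕ → ℕ → ℕ → Set where
    done : ∀ {j} → Code 0 j 0
    dep  : ∀ {e j m} → 𝔽^ j → Code e j m → Code e j (suc m)
    new  : ∀ {e j m} → 𝔽^ (suc j) → Code e (suc j) m → Code (suc e) j (suc m)

  dep-injective : ∀ {e j m a a′} {c c′ : Code e j m} → dep a c ≡ dep a′ c′ → a ≡ a′ × c ≡ c′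
  dep-injective refl = refl , refl

  new-injective : ∀ {e j m g g′} {c c′ : Code e (suc j) m} →
    new g c ≡ new g′ c′ → g ≡ g′ × c ≡ c′
  new-injective refl = refl , refl

  code : ∀ {d e j m r} {b : Vec (𝔽^ d) j} {w : Vec (𝔽^ d) m} {B : Vec (𝔽^ d) r} →
    Reduced e b w B → Code e j m
  code done                        = done
  code (dep a R)                   = dep a (code R)
  code (new {b = b} {v = v} R)     = new (map (v ∙_) (v ∷ b)) (code R)

  sameCode⇒sameGram : ∀ {d e j m r} {b b′ : Vec (𝔽^ d) j} {w w′ : Vec (𝔽^ d) m}
    {B B′ : Vec (𝔽^ d) r} (R : Reduced e b w B) (R′ : Reduced e b′ w′ B′) →
    code R ≡ code R′ → SameGram b b′ → SameGram B B′
  sameCode⇒sameGram done      done       eq same = same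
  sameCode⇒sameGram (dep _ R) (dep _ R′) eq same =
    sameCode⇒sameGram R R′ (proj₂ (dep-injective eq)) same
  sameCode⇒sameGram (new R)   (new R′)   eq same with eq₁ , eq₂ ← new-injective eq =
    sameCode⇒sameGram R R′ eq₂ (sameGram-∷ eq₁ same)

  -- Information flows backwards: each intermediate basis is a tail of the next, so agreement of `f`
  -- on the final bases passes down to all of them. Dependent vectors have equal coefficients on
  -- both sides and are therefore matched as well.
  sameCode⇒image : ∀ {d e j m r} {b b′ : Vec (𝔽^ d) j} {w w′ : Vec (𝔽^ d) m}
    {B B′ : Vec (𝔽^ d) r} (R : Reduced e b w B) (R′ : Reduced e b′ w′ B′) →
    code R ≡ code R′ → (f : 𝔽^ d → 𝔽^ d) → (∀ a → f (comb a B) ≡ comb a B′) →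
    (∀ a → f (comb a b) ≡ comb a b′) × map f w ≡ w′
  sameCode⇒image done      done       eq f f-B = f-B , refl
  sameCode⇒image (dep a R) (dep _ R′) eq f f-B with dep-injective eq
  ... | refl , eq′ with f-b , f-w ← sameCode⇒image R R′ eq′ f f-B =
    f-b , cong₂ _∷_ (f-b a) f-w
  sameCode⇒image (new {b = b} {v = v} R) (new {b = b′} {v = v′} R′) eq f f-B
    with f-vb , f-w ← sameCode⇒image R R′ (proj₂ (new-injective eq)) f f-B =
    (λ a → trans (cong f (sym (comb-0∷ a v b))) (trans (f-vb (0# ∷ a)) (comb-0∷ a v′ b′))) ,
    cong₂ _∷_ (trans (cong f (sym (comb-1∷𝟎 v b))) (trans (f-vb (1# ∷ 𝟎)) (comb-1∷𝟎 v′ b′))) f-w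

  -- On a finite set the injective map from coefficients to combinations of `B` is surjective, which
  -- provides coordinates. The isometry keeps the coordinates and replaces `B` by `B′`.
  basis-isometry : ∀ {d} {B B′ : Vec (𝔽^ d) d} → LinearlyIndependent F B → SameGram B B′ →
    ∃ λ (θ : Orthogonal F d) → ∀ a → ⟦ θ ⟧ (comb a B) ≡ comb a B′
  basis-isometry {d} {B} {B′} B-ind same = record
    { ⟦_⟧           = λ v → comb (coords v) B′
    ; isLinear      = linear-from
        (λ u v → trans (cong (λ a → comb a B′) (coords-+ᵛ u v)) (comb-+ᵛ (coords u) (coords v) B′))
        (λ c v → trans (cong (λ a → comb a B′) (coords-*ᵛ c v)) (comb-*ᵛ c (coords v) B′))
    ; dot-preserved = λ u v → trans (sym (same (coords u) (coords v)))
                                    (cong₂ _∙_ (comb-coords u) (comb-coords v))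
    } , λ a → cong (λ c → comb c B′) (injective {coords (comb a B)} {a} (comb-coords (comb a B)))
    where
    injective : ∀ {a c} → comb a B ≡ comb c B → a ≡ c
    injective = independent-injective B-ind

    coords : 𝔽^ d → 𝔽^ d
    coords v = proj₁ (injective⇒surjective F (λ a → comb a B) injective v)

    comb-coords : ∀ v → comb (coords v) B ≡ v
    comb-coords v = proj₂ (injective⇒surjective F (λ a → comb a B) injective v)

    coords-+ᵛ : ∀ u v → coords (u +ᵛ v) ≡ coords u +ᵛ coords v
    coords-+ᵛ u v = injective (trans (comb-coords _)
      (sym (trans (comb-+ᵛ (coords u) (coords v) B) (cong₂ _+ᵛ_ (comb-coords u) (comb-coords v)))))

    coords-*ᵛ : ∀ c v → coords (c *ᵛ v) ≡ c *ᵛ coords v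
    coords-*ᵛ c v = injective (trans (comb-coords _)
      (sym (trans (comb-*ᵛ c (coords v) B) (cong (c *ᵛ_) (comb-coords v)))))

  differences-congruent : ∀ {d k} (x y : Configuration F d k) (θ : Orthogonal F d) →
    map ⟦ θ ⟧ (differences x) ≡ differences y → Congruent F x y
  differences-congruent (p ∷ x) (s ∷ y) θ eq =
    subst (λ x → Congruent F x (s ∷ y)) (sym (translate-differences p x))
      (subst (Congruent F (p ∷ map (p +ᵛ_) w)) (sym (translate-differences s y))
        -- The translation is forced by the requirement that the first point `p` go to `s`.
        (θ , s +ᵛ -ᵛ ⟦ θ ⟧ p , pointwise))
    where
    open ≡-Reasoning
    w = differences (p ∷ x)

    shift : ∀ u t → s +ᵛ u ≡ (t +ᵛ u) +ᵛ (s +ᵛ -ᵛ t)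
    shift u t = begin
      s +ᵛ u                       ≡⟨ V.comm s u ⟩
      u +ᵛ s                       ≡⟨ V.xyx⁻¹≈y t (u +ᵛ s) ⟨
      (t +ᵛ (u +ᵛ s)) +ᵛ -ᵛ t      ≡⟨ cong (_+ᵛ -ᵛ t) (V.assoc t u s) ⟨
      ((t +ᵛ u) +ᵛ s) +ᵛ -ᵛ t      ≡⟨ V.assoc (t +ᵛ u) s (-ᵛ t) ⟩
      (t +ᵛ u) +ᵛ (s +ᵛ -ᵛ t)      ∎

    pointwise : ∀ i → lookup (s ∷ map (s +ᵛ_) (differences (s ∷ y))) i ≡
      ⟦ θ ⟧ (lookup (p ∷ map (p +ᵛ_) w) i) +ᵛ (s +ᵛ -ᵛ ⟦ θ ⟧ p)
    pointwise zero    = sym (trans (sym (V.assoc _ _ _)) (V.xyx⁻¹≈y (⟦ θ ⟧ p) s))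
    pointwise (suc i) = begin
      lookup (map (s +ᵛ_) (differences (s ∷ y))) i
        ≡⟨ cong (λ v → lookup (map (s +ᵛ_) v) i) eq ⟨
      lookup (map (s +ᵛ_) (map ⟦ θ ⟧ w)) i
        ≡⟨ trans (Vec.lookup-map i _ (map ⟦ θ ⟧ w)) (cong (s +ᵛ_) (Vec.lookup-map i _ w)) ⟩
      s +ᵛ ⟦ θ ⟧ (lookup w i)
        ≡⟨ shift (⟦ θ ⟧ (lookup w i)) (⟦ θ ⟧ p) ⟩
      (⟦ θ ⟧ p +ᵛ ⟦ θ ⟧ (lookup w i)) +ᵛ (s +ᵛ -ᵛ ⟦ θ ⟧ p)
        ≡⟨ cong (_+ᵛ (s +ᵛ -ᵛ ⟦ θ ⟧ p))
             (trans (cong ⟦ θ ⟧ (Vec.lookup-map i _ w)) (orthogonal-+ᵛ θ p (lookup w i))) ⟨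
      ⟦ θ ⟧ (lookup (map (p +ᵛ_) w) i) +ᵛ (s +ᵛ -ᵛ ⟦ θ ⟧ p)  ∎

  module _ {d k} {x y : Configuration F d k} where

    -- Extending the correspondence of bases to an isometry is left to `extend`, so that rank 0 and
    -- rank `d` share the argument.
    sameCode⇒congruent : ∀ {e} (P : Profile x e) (Q : Profile y e) →
      (SameGram (proj₁ P) (proj₁ Q) →
        ∃ λ (θ : Orthogonal F d) → ∀ a → ⟦ θ ⟧ (comb a (proj₁ P)) ≡ comb a (proj₁ Q)) →
      code (proj₂ (proj₂ P)) ≡ code (proj₂ (proj₂ Q)) → Congruent F x y
    sameCode⇒congruent (_ , _ , R) (_ , _ , R′) extend eq
      with θ , θ-B ← extend (sameCode⇒sameGram R R′ eq λ { [] [] → refl }) =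
      differences-congruent x y θ (proj₂ (sameCode⇒image R R′ eq ⟦ θ ⟧ θ-B))

  -- Numbering of codes and of congruence classes.

  codeIndex : ∀ {e j m} → Code e j m → Fin (codeCount q e j m)
  codeIndex done                  = zero
  codeIndex {zero}  (dep a c)     = combine (encode F a) (codeIndex c)
  codeIndex {suc _} (dep a c)     = combine (encode F a) (codeIndex c) ↑ˡ _
  codeIndex {suc e} {j} {suc m} (new g c) =
    q ^ j * codeCount q (suc e) j m ↑ʳ combine (encode F g) (codeIndex c)

  codeIndex-injective : ∀ {e j m} (c c′ : Code e j m) → codeIndex c ≡ codeIndex c′ → c ≡ c′
  codeIndex-injective done done _ = refl
  codeIndex-injective {zero} (dep a c) (dep a′ c′) eq
    with eq₁ , eq₂ ← Fin.combine-injective _ (codeIndex c) _ (codeIndex c′) eq =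
    cong₂ dep (encode-injective F eq₁) (codeIndex-injective c c′ eq₂)
  codeIndex-injective {suc _} (dep a c) (dep a′ c′) eq
    with eq₁ , eq₂ ← Fin.combine-injective _ (codeIndex c) _ (codeIndex c′) (Fin.↑ˡ-injective _ _ _ eq) =
    cong₂ dep (encode-injective F eq₁) (codeIndex-injective c c′ eq₂)
  codeIndex-injective {suc _} (new g c) (new g′ c′) eq
    with eq₁ , eq₂ ← Fin.combine-injective _ (codeIndex c) _ (codeIndex c′) (Fin.↑ʳ-injective _ _ _ eq) =
    cong₂ new (encode-injective F eq₁) (codeIndex-injective c c′ eq₂)
  codeIndex-injective {suc _} (dep a c) (new g c′) eq = ⊥-elim (↑ˡ≢↑ʳ _ _ eq)
  codeIndex-injective {suc _} (new g c) (dep a c′) eq = ⊥-elim (↑ˡ≢↑ʳ _ _ (sym eq))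

  module _ {d k : ℕ} where

    classCode : ∃ (∁ (D F {d} {k})) → Fin (codeCount q 0 0 k ℕ.+ codeCount q d 0 k)
    classCode (x , x∉D) with profile x x∉D
    ... | inj₁ (_ , _ , R) = codeIndex (code R) ↑ˡ _
    ... | inj₂ (_ , _ , R) = codeCount q 0 0 k ↑ʳ codeIndex (code R)

    classCode-injective : ∀ x y → classCode x ≡ classCode y → Congruent F (proj₁ x) (proj₁ y)
    classCode-injective (x , x∉D) (y , y∉D) eq with profile x x∉D | profile y y∉D
    ... | inj₁ P@([] , _ , R) | inj₁ Q@([] , _ , R′) =
      -- In rank 0 both bases are empty, so the identity serves as the isometry.
      sameCode⇒congruent {x = x} {y} P Q (λ _ → identity F , λ { [] → refl })
        (codeIndex-injective _ _ (Fin.↑ˡ-injective _ _ _ eq))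
    ... | inj₁ _ | inj₂ _ = ⊥-elim (↑ˡ≢↑ʳ _ _ eq)
    ... | inj₂ _ | inj₁ _ = ⊥-elim (↑ˡ≢↑ʳ _ _ (sym eq))
    ... | inj₂ P@(_ , B-ind , R) | inj₂ Q@(_ , _ , R′) =
      sameCode⇒congruent {x = x} {y} P Q (basis-isometry B-ind)
        (codeIndex-injective _ _ (Fin.↑ʳ-injective _ _ _ eq))

  -- Nonzero elements, squares and signs.

  nonzero : Fin (ℕ.pred q) → Carrier
  nonzero i = fromFin (avoid (toFin 0#) i)

  nonzero≢0 : ∀ i → nonzero i ≢ 0#
  nonzero≢0 i eq = avoid-≢ (toFin 0#) i
    (trans (sym (Inverse.strictlyInverseˡ finite _)) (cong toFin eq))

  nonzero-injective : ∀ {i j} → nonzero i ≡ nonzero j → i ≡ j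
  nonzero-injective = avoid-injective (toFin 0#) ∘ fromFin-injective

  ·-cancelˡ : ∀ {t x y} → t ≢ 0# → t · x ≡ t · y → x ≡ y
  ·-cancelˡ {t} {x} {y} t≢0 eq with s , ts≡1 ← inverse t t≢0 =
    trans (sym (undo x)) (trans (cong (s ·_) eq) (undo y))
    where
    undo : ∀ z → s · (t · z) ≡ z
    undo z = trans (sym (R.*-assoc s t z))
      (trans (cong (_· z) (trans (R.*-comm s t) ts≡1)) (R.*-identityˡ z))

  square≡⇒≡± : ∀ {x y} → x · x ≡ y · y → x ≡ y ⊎ x ≡ - y
  square≡⇒≡± {x} {y} eq with (x + - y) ≟ 0#
  ... | yes x-y≡0 = inj₁ (R.x∙y⁻¹≈ε⇒x≈y x y x-y≡0)
  -- The product of `x - y` and `x + y` vanishes, and the nonzero first factor can be cancelled.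
  ... | no  x-y≢0 = inj₂ (R.+-inverseˡ-unique x y (·-cancelˡ x-y≢0 (begin
    (x + - y) · (x + y)              ≡⟨ R.distribʳ (x + y) x (- y) ⟩
    x · (x + y) + (- y) · (x + y)
      ≡⟨ cong₂ _+_ (R.distribˡ x x y) (sym (R.-‿distribˡ-* y (x + y))) ⟩
    x · x + x · y + - (y · (x + y))
      ≡⟨ cong₂ (λ s t → s + - t) (cong (_+ x · y) eq) (R.distribˡ y x y) ⟩
    y · y + x · y + - (y · x + y · y)
      ≡⟨ cong (_+ - (y · x + y · y)) (trans (R.+-comm _ _) (cong (_+ y · y) (R.*-comm x y))) ⟩
    y · x + y · y + - (y · x + y · y)  ≡⟨ R.-‿inverseʳ _ ⟩
    0#                               ≡⟨ R.zeroʳ (x + - y) ⟨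
    (x + - y) · 0#                   ∎)))
    where open ≡-Reasoning

  -- A bit that tells `x` from `- x` when they differ, read off from their positions in the
  -- enumeration of the field.
  sign : Carrier → Fin 2
  sign x = comparison (toFin x) (toFin (- x))

  -- As negation is an involution, `sign (- y)` is the comparison defining `sign y` with its
  -- arguments swapped.
  sign-- : ∀ y → sign (- y) ≡ sign y → - y ≡ y
  sign-- y eq = toFin-injective (comparison-symmetric (toFin (- y)) (toFin y)
    (trans (cong (λ z → comparison (toFin (- y)) (toFin z)) (sym (R.-‿involutive y))) eq))

  square-sign-injective : ∀ {x y} → x · x ≡ y · y → sign x ≡ sign y → x ≡ y
  square-sign-injective {x} {y} eq sign≡ with square≡⇒≡± eq
  ... | inj₁ x≡y  = x≡y
  ... | inj₂ refl = sign-- y sign≡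

  -- Triangular configurations and their Gram matrices.

  -- Parameters of the m × d matrices [t 0; s V] with t ≠ 0 and V of the same
  -- kind, of size (m - 1) × (d - 1).
  Triangle : ℕ → ℕ → Set
  Triangle zero    m       = ⊤
  Triangle (suc d) zero    = ⊥
  Triangle (suc d) (suc m) = (Fin (ℕ.pred q) × 𝔽^ m) × Triangle d m

  triangles : ∀ d m → Fin (triangleCount q d m) ↣ Triangle d m
  triangles zero    m       = mk↣ {to = λ _ → tt} λ { {zero} {zero} _ → refl }
  triangles (suc d) zero    = mk↣ {to = λ ()} λ { {()} }
  triangles (suc d) (suc m) =
    ((↣-id _ ×-↣ mk↣ (decode-injective m)) ↣-∘ ↔⇒↣ Fin.*↔× ×-↣ triangles d m) ↣-∘ ↔⇒↣ Fin.*↔×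

  triangular : ∀ {d m} → Triangle d m → Vec (𝔽^ d) m
  triangular {zero}          _             = Vec.replicate _ []
  triangular {suc d} {suc m} ((t , s) , τ) = (nonzero t ∷ 𝟎) ∷ zipWith _∷_ s (triangular τ)

  -- The signs of the diagonal entries: the part of a triangular factor that its Gram matrix leaves
  -- open.
  signs : ∀ {d m} → Triangle d m → Fin (2 ^ d)
  signs {zero}          _             = zero
  signs {suc d} {suc m} ((t , _) , τ) = combine (sign (nonzero t)) (signs τ)

  -- Substitution along the triangle: the smaller block produces all coordinates but the first, and
  -- the first row then corrects that one alone.
  triangular-spanning : ∀ {d m} (τ : Triangle d m) v → ∃ λ a → v ≡ comb a (triangular τ)
  triangular-spanning {zero} {m} τ [] with comb {m = m} 𝟎 (triangular τ) in eq
  ... | [] = 𝟎 , sym eq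
  triangular-spanning {suc d} {suc m} ((t , s) , τ) (x ∷ v)
    with a , refl ← triangular-spanning τ v | y , ty≡1 ← inverse (nonzero t) (nonzero≢0 t) =
    z · y ∷ a , sym (begin
      (z · y) *ᵛ (nonzero t ∷ 𝟎) +ᵛ comb a (zipWith _∷_ s (triangular τ))
        ≡⟨ cong ((z · y) *ᵛ (nonzero t ∷ 𝟎) +ᵛ_) (comb-zipWith-∷ a s (triangular τ)) ⟩
      z · y · nonzero t + a ∙ s ∷ (z · y) *ᵛ 𝟎 +ᵛ comb a (triangular τ)
        ≡⟨ cong₂ _∷_ first (trans (cong (_+ᵛ comb a (triangular τ)) (*ᵛ-zeroʳ (z · y))) (V.identityˡ _)) ⟩
      x ∷ comb a (triangular τ)  ∎)
    where
    open ≡-Reasoning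
    -- The first coordinate still missing after the lower rows have contributed; `y` divides it by
    -- the pivot.
    z = x + - (a ∙ s)
    first : z · y · nonzero t + a ∙ s ≡ x
    first = begin
      z · y · nonzero t + a ∙ s    ≡⟨ cong (_+ a ∙ s) (R.*-assoc z y (nonzero t)) ⟩
      z · (y · nonzero t) + a ∙ s
        ≡⟨ cong (λ u → z · u + a ∙ s) (trans (R.*-comm y (nonzero t)) ty≡1) ⟩
      z · 1# + a ∙ s               ≡⟨ cong (_+ a ∙ s) (R.*-identityʳ z) ⟩
      x + - (a ∙ s) + a ∙ s        ≡⟨ R.+-assoc x _ _ ⟩
      x + (- (a ∙ s) + a ∙ s)      ≡⟨ cong (x +_) (R.-‿inverseˡ (a ∙ s)) ⟩
      x + 0#                       ≡⟨ R.+-identityʳ x ⟩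
      x                            ∎

  -- If the affine span, here the whole space, had `r < d` basis directions, coefficients in that
  -- basis would inject `d`-space into `r`-space.
  spanning⇒∉D : ∀ {d k} (w : Vec (𝔽^ d) k) → (∀ v → ∃ λ a → v ≡ comb a w) → ¬ D F (𝟎 ∷ w)
  spanning⇒∉D {d} w w-spans (r , _ , r<d , p , b , _ , span⊆ , _) =
    ℕ.<⇒≱ r<d (injective⇒dim≤ coefficients coefficients-injective)
    where
    in-span : ∀ v → AffineSpan F (𝟎 ∷ w) v
    in-span v with a , refl ← w-spans v =
      subst (AffineSpan F (𝟎 ∷ w)) (V.identityˡ _)
        (subst (λ u → AffineSpan F (𝟎 ∷ u) (𝟎 +ᵛ comb a w))
          (trans (Vec.map-cong V.identityˡ w) (Vec.map-id w)) (affineSpan⁻ 𝟎 w a))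

    coefficients : 𝔽^ d → 𝔽^ r
    coefficients v = proj₁ (span⊆ (in-span v))

    coefficients-injective : ∀ {u v} → coefficients u ≡ coefficients v → u ≡ v
    coefficients-injective {u} {v} eq = trans (proj₂ (span⊆ (in-span u)))
      (trans (cong (λ a → p +ᵛ comb a b) eq) (sym (proj₂ (span⊆ (in-span v)))))

  configuration : ∀ {d k} → Triangle d k → ∃ (∁ (D F {d} {k}))
  configuration τ = 𝟎 ∷ triangular τ , spanning⇒∉D _ (triangular-spanning τ)

  -- Both configurations start at the origin, so the translation is zero and the remaining points
  -- correspond under an orthogonal map.
  congruent⇒sameDots : ∀ {d k} {v w : Vec (𝔽^ d) k} → Congruent F (𝟎 ∷ v) (𝟎 ∷ w) →
    ∀ i j → lookup v i ∙ lookup v j ≡ lookup w i ∙ lookup w j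
  congruent⇒sameDots {v = v} {w} (θ , z , h) i j =
    trans (sym (Orthogonal.dot-preserved θ (lookup v i) (lookup v j)))
          (sym (cong₂ _∙_ (w≡θv i) (w≡θv j)))
    where
    𝟎≡z : 𝟎 ≡ z
    𝟎≡z = trans (h zero) (trans (cong (_+ᵛ z) (orthogonal-𝟎 θ)) (V.identityˡ z))

    w≡θv : ∀ i → lookup w i ≡ ⟦ θ ⟧ (lookup v i)
    w≡θv i = trans (h (suc i)) (trans (cong (⟦ θ ⟧ (lookup v i) +ᵛ_) (sym 𝟎≡z)) (V.identityʳ _))

  dot-∷𝟎 : ∀ {d} t x (v : 𝔽^ d) → (t ∷ 𝟎) ∙ (x ∷ v) ≡ t · x
  dot-∷𝟎 t x v = trans (cong (t · x +_) (dot-zeroˡ v)) (R.+-identityʳ (t · x))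

  module _ {d m} {s s′ : 𝔽^ m} {V V′ : Vec (𝔽^ d) m} where

    -- Against the first row `t ∷ 𝟎` each later row yields `t` times its first entry, and `t`
    -- cancels.
    first-column : ∀ {t} → t ≢ 0# →
      (∀ i → (t ∷ 𝟎) ∙ lookup (zipWith _∷_ s V) i ≡ (t ∷ 𝟎) ∙ lookup (zipWith _∷_ s′ V′) i) →
      s ≡ s′
    first-column {t} t≢0 dots = trans (sym (Vec.tabulate∘lookup s))
      (trans (Vec.tabulate-cong λ i → ·-cancelˡ t≢0 (begin
        t · lookup s i                            ≡⟨ entry s V i ⟨
        (t ∷ 𝟎) ∙ lookup (zipWith _∷_ s V) i      ≡⟨ dots i ⟩
        (t ∷ 𝟎) ∙ lookup (zipWith _∷_ s′ V′) i    ≡⟨ entry s′ V′ i ⟩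
        t · lookup s′ i                           ∎))
      (Vec.tabulate∘lookup s′))
      where
      open ≡-Reasoning
      entry : ∀ s (V : Vec (𝔽^ d) m) i → (t ∷ 𝟎) ∙ lookup (zipWith _∷_ s V) i ≡ t · lookup s i
      entry s V i = trans (cong ((t ∷ 𝟎) ∙_) (Vec.lookup-zipWith _∷_ i s V))
                          (dot-∷𝟎 t (lookup s i) (lookup V i))

    -- Subtracting the contribution of the common first column leaves the Gram matrix of the smaller
    -- block.
    remaining-columns : ∀ i j → s ≡ s′ →
      lookup (zipWith _∷_ s V) i ∙ lookup (zipWith _∷_ s V) j ≡
      lookup (zipWith _∷_ s′ V′) i ∙ lookup (zipWith _∷_ s′ V′) j →
      lookup V i ∙ lookup V j ≡ lookup V′ i ∙ lookup V′ j
    remaining-columns i j refl dots = R.+-cancelˡ (lookup s i · lookup s j) _ _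
      (trans (sym (split V)) (trans dots (split V′)))
      where
      split : ∀ V → lookup (zipWith _∷_ s V) i ∙ lookup (zipWith _∷_ s V) j ≡
        lookup s i · lookup s j + lookup V i ∙ lookup V j
      split V = cong₂ _∙_ (Vec.lookup-zipWith _∷_ i s V) (Vec.lookup-zipWith _∷_ j s V)

  -- Uniqueness of the Cholesky factorisation.
  triangular-unique : ∀ {d m} (τ τ′ : Triangle d m) →
    (∀ i j → lookup (triangular τ) i ∙ lookup (triangular τ) j ≡
             lookup (triangular τ′) i ∙ lookup (triangular τ′) j) →
    signs τ ≡ signs τ′ → τ ≡ τ′
  triangular-unique {zero} _ _ _ _ = refl
  triangular-unique {suc d} {suc m} ((t , s) , τ) ((t′ , s′) , τ′) dots signs≡
    with sign≡ , signs≡′ ← Fin.combine-injective (sign (nonzero t)) (signs τ)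
                                                 (sign (nonzero t′)) (signs τ′) signs≡
    -- The corner entry of the Gram matrix is the square of the first pivot, and the sign selects
    -- the root.
    with refl ← nonzero-injective {t} {t′} (square-sign-injective
           (trans (sym (dot-∷𝟎 (nonzero t) (nonzero t) (𝟎 {d})))
             (trans (dots zero zero) (dot-∷𝟎 (nonzero t′) (nonzero t′) (𝟎 {d})))) sign≡)
    with refl ← first-column {s = s} {s′} {triangular τ} {triangular τ′} (nonzero≢0 t)
                  (λ i → dots zero (suc i)) =
    cong ((t , s) ,_) (triangular-unique τ τ′
      (λ i j → remaining-columns {s = s} i j refl (dots (suc i) (suc j))) signs≡′)

  -- Bounds on the number of congruence classes.

  module _ {d k N} (card : HasCardinality (Δ F {d} k (∁ (D F))) N) where

    cardinality-upper : N ≤ codeCount q 0 0 k ℕ.+ codeCount q d 0 k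
    cardinality-upper = cardinality-≤ card classCode λ {x} {y} → classCode-injective x y

    -- Within one congruence class the Gram matrix of the rows is fixed, so a triangle is determined
    -- by its class together with its signs.
    cardinality-lower : triangleCount q d k ≤ N * 2 ^ d
    cardinality-lower = Fin.injective⇒≤ {f = index ∘ Injection.to (triangles d k)}
      (Injection.injective (triangles d k) ∘ index-injective _ _)
      where
      index : Triangle d k → Fin (N * 2 ^ d)
      index τ = combine (class card (configuration τ)) (signs τ)

      index-injective : ∀ τ τ′ → index τ ≡ index τ′ → τ ≡ τ′
      index-injective τ τ′ eq
        with eq₁ , eq₂ ← Fin.combine-injective (class card (configuration τ)) (signs τ)
                           (class card (configuration τ′)) (signs τ′) eq =
        triangular-unique τ τ′ (congruent⇒sameDots (class-injective card eq₁)) eq₂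

theorem3 : ∀ (d : ℕ) → 1 ≤ d →
    ∃₂ λ (c₁ c₂ : ℚ) → 0ℚ ℚ.< c₁ × 0ℚ ℚ.< c₂ ×
    (∀ (k q : ℕ) → d ≤ k → OddPrimePower q → (F : FiniteField q) →
    ∃ λ (N : ℕ) → HasCardinality (Δ F k (∁ (D F {d} {k}))) N ×
    c₁ ℚ.* fromℕ (q ^ (d * suc k ∸ (suc d C 2))) ℚ.≤ fromℕ N ×
    fromℕ N ℚ.≤ c₂ ℚ.* fromℕ (q ^ (d * suc k ∸ (suc d C 2))))
theorem3 d _ =
  -- Both constants depend on `d` alone. `K` is `4 ^ d`, the loss in `lower-bound`; in the upper
  -- constant the summand 1 allows for configurations whose points all coincide.
  reciprocal K , fromℕ (1 ℕ.+ 2 ^ d) ,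
  ℚ.positive⁻¹ _ {{reciprocal-positive K}} ,
  ℚ.positive⁻¹ _ {{fromℕ-positive (1 ℕ.+ 2 ^ d)}} ,
  λ k q d≤k _ F → estimate d≤k F (Δ-cardinality F d k)
  where
  K = 2 ^ d * 2 ^ d
  instance
    K≢0 : ℕ.NonZero K
    K≢0 = ℕ.m*n≢0 (2 ^ d) (2 ^ d) {{ℕ.m^n≢0 2 d}} {{ℕ.m^n≢0 2 d}}

  estimate : ∀ {k q} → d ≤ k → (F : FiniteField q) →
    ∃ (HasCardinality (Δ F k (∁ (D F {d} {k})))) →
    ∃ λ N → HasCardinality (Δ F k (∁ (D F {d} {k}))) N ×
      reciprocal K ℚ.* fromℕ (q ^ (d * suc k ∸ suc d C 2)) ℚ.≤ fromℕ N ×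
      fromℕ N ℚ.≤ fromℕ (1 ℕ.+ 2 ^ d) ℚ.* fromℕ (q ^ (d * suc k ∸ suc d C 2))
  estimate d≤k F (N , card) = N , card ,
    reciprocal-≤ {c = K} {N} (lower-bound (1<q F) {N = N} d≤k (cardinality-lower F card)) ,
    fromℕ-≤-* {c = 1 ℕ.+ 2 ^ d} (upper-bound (1<q F) d≤k (cardinality-upper F card))
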